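{- For every $d\ge 3$ there is a constant $c=c(d)$ such that for all $n\ge 2$, $OSH_d(n)\le\mathrm{twr}_{d-1}(c n^2\log n)$.
   Context: The tower function is defined by $\mathrm{twr}_1(x)=x$ and $\mathrm{twr}_{i+1}(x)=2^{\mathrm{twr}_i(x)}$. A set $H$ of hyperplanes in $\mathbb{R}^d$ is in general position if every $d$ members of $H$ intersect in a single point, distinct for distinct $d$-subsets. Such $H$ is one-sided if the vertex set of its arrangement (the set of all these intersection points) lies entirely on one side of the hyperplane $x_d=0$. $OSH_d(n)$ is the smallest integer $N$ such that every set of $N$ hyperplanes in $\mathbb{R}^d$ in general position contains $n$ members that are one-sided. -}

module Defs where

open import Data.Nat as ℕ using (ℕ; zero; suc; _^_)
open import Data.Fin as Fin using (Fin; fromℕ)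
open import Data.Product using (Σ; ∃; _×_; _,_)
open import Data.Sum using (_⊎_)
open import Relation.Binary.PropositionalEquality using (_≡_; _≢_)
open import Relation.Nullary using (¬_)

-- Tower function: twr 1 x = x, twr (i+1) x = 2 ^ twr i x.
-- (twr 0 x = x is an irrelevant convention; only i ≥ 1 is used.)
twr : ℕ → ℕ → ℕ
twr zero x = x
twr (suc zero) x = x
twr (suc (suc i)) x = 2 ^ twr (suc i) x

-- The real numbers, axiomatised as a complete ordered field
-- (this characterises ℝ up to isomorphism).
record RealField : Set₁ where
  infixl 6 _+_
  infixl 7 _*_
  infix 4 _<_ _≤_
  field
    Carrier : Set
    0r 1r : Carrier
    _+_ _*_ : Carrier → Carrier → Carrier
    -_ : Carrier → Carrier
    _<_ : Carrier → Carrier → Set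
    +-assoc : ∀ x y z → (x + y) + z ≡ x + (y + z)
    +-comm : ∀ x y → x + y ≡ y + x
    +-identityˡ : ∀ x → 0r + x ≡ x
    +-inverseˡ : ∀ x → (- x) + x ≡ 0r
    *-assoc : ∀ x y z → (x * y) * z ≡ x * (y * z)
    *-comm : ∀ x y → x * y ≡ y * x
    *-identityˡ : ∀ x → 1r * x ≡ x
    distribˡ : ∀ x y z → x * (y + z) ≡ x * y + x * z
    0≢1 : 0r ≢ 1r
    *-inverse : ∀ x → x ≢ 0r → ∃ λ y → x * y ≡ 1r
    <-irrefl : ∀ x → ¬ (x < x)
    <-trans : ∀ {x y z} → x < y → y < z → x < z
    <-trichotomy : ∀ x y → (x < y) ⊎ (x ≡ y) ⊎ (y < x)
    +-mono-< : ∀ {x y} z → x < y → x + z < y + z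
    *-pos : ∀ {x y} → 0r < x → 0r < y → 0r < x * y
  _≤_ : Carrier → Carrier → Set
  x ≤ y = (x < y) ⊎ (x ≡ y)
  field
    sup : (P : Carrier → Set) → ∃ P → (∃ λ u → ∀ x → P x → x ≤ u) →
          ∃ λ s → (∀ x → P x → x ≤ s) × (∀ u → (∀ x → P x → x ≤ u) → s ≤ u)

module _ (R : RealField) where
  open RealField R

  Point : ℕ → Set
  Point d = Fin d → Carrier

  sumF : ∀ {d} → (Fin d → Carrier) → Carrier
  sumF {zero} f = 0r
  sumF {suc d} f = f Fin.zero + sumF (λ i → f (Fin.suc i))

  record Hyperplane (d : ℕ) : Set where
    field
      normal : Fin d → Carrier
      normal≢0 : ∃ λ i → normal i ≢ 0r
      offset : Carrier

  OnHyperplane : ∀ {d} → Hyperplane d → Point d → Set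
  OnHyperplane h x = sumF (λ i → Hyperplane.normal h i * x i) ≡ Hyperplane.offset h

  -- a d-subset of Fin N, as a strictly increasing map Fin d → Fin N
  IsSubset : ∀ {d N} → (Fin d → Fin N) → Set
  IsSubset s = ∀ i j → i Fin.< j → s i Fin.< s j

  IsMeet : ∀ {d N} → (Fin N → Hyperplane d) → (Fin d → Fin N) → Point d → Set
  IsMeet H s x = ∀ i → OnHyperplane (H (s i)) x

  GeneralPosition : ∀ {d N} → (Fin N → Hyperplane d) → Set
  GeneralPosition {d} {N} H =
    (∀ (s : Fin d → Fin N) → IsSubset s →
       ∃ λ x → IsMeet H s x × (∀ y → IsMeet H s y → y ≡ x))
    × (∀ (s t : Fin d → Fin N) → IsSubset s → IsSubset t →
       ∀ x y → IsMeet H s x → IsMeet H t y → x ≡ y → ∀ i → s i ≡ t i)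

  IsVertex : ∀ {d N} → (Fin N → Hyperplane d) → Point d → Set
  IsVertex {d} {N} H x = ∃ λ (s : Fin d → Fin N) → IsSubset s × IsMeet H s x

  -- one-sided (dimension d = suc k, last coordinate x_d = x (fromℕ k)):
  -- all vertices strictly on one side of {x_d = 0}
  OneSided : ∀ {k N} → (Fin N → Hyperplane (suc k)) → Set
  OneSided {k} H =
    (∀ x → IsVertex H x → 0r < x (fromℕ k))
    ⊎ (∀ x → IsVertex H x → x (fromℕ k) < 0r)

  OSHProperty : ℕ → ℕ → ℕ → Set
  OSHProperty k n N =
    ∀ (H : Fin N → Hyperplane (suc k)) → GeneralPosition H →
      ∃ λ (ι : Fin n → Fin N) → (∀ i j → ι i ≡ ι j → i ≡ j) × OneSided (λ i → H (ι i))

  -- OSH_{suc k}(n) ≤ M  (OSH is the least N with OSHProperty)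
  OSH≤ : ℕ → ℕ → ℕ → Set
  OSH≤ k n M = ∃ λ N → N ℕ.≤ M × OSHProperty k n N

{-# OPTIONS --safe #-}
module Submission where

-- Color a d-tuple of hyperplanes by the sign of the height x_d of its vertex. With all but one of the
-- hyperplanes fixed, this sign is the product of the signs of two linear forms in the coefficients of
-- the remaining one, so m tuples of d - 1 hyperplanes induce only polynomially many color patterns
-- on the others: the cells of an arrangement of 2m linear forms in ℝ^(d+1). In the Erdős-Rado argument
-- this replaces the trivial bound 2^m and lowers the uniformity by one at the cost of
-- N ↦ 2^(C N log N). Since the hyperplanes that are split off stay fixed, the colorings of lower
-- uniformity are of the same kind. For pairs the d - 2 fixed hyperplanes cut out a plane, where the
-- color of two lines compares the order of their slopes with that of their intersections with
-- x_d = 0, and the Erdős-Szekeres argument needs only O(n²) lines. The third color, height zero, is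
-- harmless: d + 1 hyperplanes in general position bound a simplex, which does not lie in x_d = 0.

open import Defs
open import Level using (0ℓ)
open import Algebra using (CommutativeRing; RawRing)
open import Algebra.Structures using (IsCommutativeRing)
import Algebra.Properties.Ring
import Algebra.Properties.Semiring.Mult
import Algebra.Solver.Ring
import Algebra.Solver.Ring.AlmostCommutativeRing as ACR
open import Data.Empty using (⊥-elim)
open import Data.Fin as Fin using (Fin; punchIn; fromℕ)
import Data.Fin.Properties as Fin
open import Data.List
  using (List; []; _∷_; [_]; _++_; _ʳ++_; allFin; cartesianProductWith; filter; initLast; _∷ʳ′_;
         length; lookup; map; reverse; tabulate; take)
open import Data.List.Membership.Propositional using (_∈_; find; lose)
open import Data.List.Membership.Propositional.Properties
  using (∈-++⁺ˡ; ∈-++⁺ʳ; ∈-++⁻; ∈-cartesianProductWith⁺; ∈-filter⁻; ∈-lookup; ∈-map⁺; ∈-map⁻;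
         ∈-tabulate⁻)
open import Data.List.Properties
  using (++-assoc; ++-identityʳ; ∷-injective; length-++; length-map; length-tabulate; length-take;
         map-∘; map-cong; reverse-involutive; ≡-dec)
open import Data.List.Relation.Binary.Sublist.Propositional
  using (_⊆_; []; _∷_; _∷ʳ_; ⊆-refl; ⊆-trans; from∈; minimum)
open import Data.List.Relation.Binary.Sublist.Propositional.Properties
  using (++⁺; ++⁺ʳ; ʳ++⁺; All-resp-⊆; Any-resp-⊆; filter-⊆; take-⊆)
open import Data.List.Relation.Unary.All as All using (All; []; _∷_)
import Data.List.Relation.Unary.All.Properties as All
open import Data.List.Relation.Unary.AllPairs as AllPairs using (AllPairs; []; _∷_; allPairs?)
import Data.List.Relation.Unary.AllPairs.Properties as AllPairs
open import Data.List.Relation.Unary.Any using (any?; here; index; there)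
open import Data.List.Relation.Unary.Any.Properties using (lookup-index)
open import Data.Maybe using (Maybe; just; nothing)
open import Data.Nat as ℕ using (ℕ; zero; suc; z≤n; s≤s; s≤s⁻¹; ⌊_/2⌋; ⌈_/2⌉; >-nonZero)
open import Data.Nat.Induction using (<-wellFounded)
open import Data.Nat.Logarithm using (⌈log₂_⌉)
open import Data.Nat.Logarithm.Core using (⌈log2⌉)
import Data.Nat.Properties as ℕ
open import Data.Nat.Tactic.RingSolver using (solve-∀)
open import Data.Product using (∃; ∃₂; _×_; _,_; proj₁; proj₂)
open import Data.Sum using (_⊎_; inj₁; inj₂)
open import Data.Unit using (⊤; tt)
open import Data.Vec.Functional using (insertAt)
open import Data.Vec.Functional.Properties using (insertAt-lookup; insertAt-punchIn)
open import Function using (_∘_; id)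
open import Induction.WellFounded using (Acc; acc)
open import Relation.Binary.Definitions using (Decidable; DecidableEquality; tri<; tri≈; tri>)
open import Relation.Binary.PropositionalEquality hiding ([_])
open import Relation.Nullary using (¬_; ¬?; Dec; yes; no; contradiction; _×-dec_)
import Relation.Unary as Unary

-- Raising the uniformity from 2 to d takes d - 2 steps at one exponential each, which is the height
-- of `twr (d - 1)` over the bound for pairs. The logarithm in the theorem comes from the lowest
-- step alone: there N = O(n²), so C N log N = O(n² log n). In every later step N is itself at most
-- 2^T, and C N log N ≤ 2^(O(T)); the extra factor turns into a constant that slides to the top of
-- the tower. The bound for pairs stays quadratic because the color zero is ruled out by d + 1
-- hyperplanes already: its target size does not grow with n, and only the two other colors
-- contribute a factor n. Cells are not treated as subsets of space. Only the sign patterns that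
-- occur on a finite sample of points are counted, so that it is decidable whether a pattern occurs;
-- the bound does not depend on the sample. The hyperplanes that are split off are always the last
-- of a tuple, so a tuple is `s ++ t` with `t` fixed and remains increasing.

-- The reals as a commutative ring, with a ring solver

module RealRing (R : RealField) where
  open RealField R public

  isCommutativeRing : IsCommutativeRing _≡_ _+_ _*_ -_ 0r 1r
  isCommutativeRing = record
    { isRing = record
      { +-isAbelianGroup = record
        { isGroup = record
          { isMonoid = record
            { isSemigroup = record
              { isMagma = record { isEquivalence = isEquivalence ; ∙-cong = cong₂ _+_ }
              ; assoc = +-assoc }
            ; identity = +-identityˡ , λ x → trans (+-comm x 0r) (+-identityˡ x) }
          ; inverse = +-inverseˡ , λ x → trans (+-comm x (- x)) (+-inverseˡ x)
          ; ⁻¹-cong = cong (-_) }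
        ; comm = +-comm }
      ; *-cong = cong₂ _*_
      ; *-assoc = *-assoc
      ; *-identity = *-identityˡ , λ x → trans (*-comm x 1r) (*-identityˡ x)
      ; distrib = distribˡ , λ x y z → trans (*-comm (y + z) x)
          (trans (distribˡ x y z) (cong₂ _+_ (*-comm x y) (*-comm x z))) }
    ; *-comm = *-comm }

  commutativeRing : CommutativeRing 0ℓ 0ℓ
  commutativeRing = record { isCommutativeRing = isCommutativeRing }

  open CommutativeRing commutativeRing public
    using (ring; semiring; +-identityʳ; *-identityʳ; zeroˡ; zeroʳ; +-commutativeMonoid)
  open Algebra.Properties.Ring ring
    using (-‿distribˡ-*; -‿distribʳ-*; -0#≈0#; -‿involutive) renaming (-‿+-comm to neg-+)
  open Algebra.Properties.Semiring.Mult semiring using (×1-homo-*; ×-homo-+) renaming (_×_ to _·_)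

  -- (m , n) stands for m - n.
  integers : RawRing 0ℓ 0ℓ
  integers = record
    { Carrier = ℕ × ℕ ; _≈_ = _≡_
    ; _+_ = λ (a , b) (c , d) → a ℕ.+ c , b ℕ.+ d
    ; _*_ = λ (a , b) (c , d) → a ℕ.* c ℕ.+ b ℕ.* d , a ℕ.* d ℕ.+ b ℕ.* c
    ; -_ = λ (a , b) → b , a
    ; 0# = 0 , 0 ; 1# = 1 , 0 }

  private
    open ≡-Reasoning

    val : ℕ × ℕ → Carrier
    val (a , b) = a · 1r + - (b · 1r)

    interchange : ∀ a b c d → (a + b) + (c + d) ≡ (a + c) + (b + d)
    interchange a b c d = begin
      (a + b) + (c + d)  ≡⟨ +-assoc a b (c + d) ⟩
      a + (b + (c + d))  ≡⟨ cong (a +_) (+-assoc b c d) ⟨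
      a + ((b + c) + d)  ≡⟨ cong (λ z → a + (z + d)) (+-comm b c) ⟩
      a + ((c + b) + d)  ≡⟨ cong (a +_) (+-assoc c b d) ⟩
      a + (c + (b + d))  ≡⟨ +-assoc a c (b + d) ⟨
      (a + c) + (b + d)  ∎

    val-+ : ∀ p q → val (RawRing._+_ integers p q) ≡ val p + val q
    val-+ (a , b) (c , d) = begin
      (a ℕ.+ c) · 1r + - ((b ℕ.+ d) · 1r)
        ≡⟨ cong₂ (λ x y → x + - y) (×-homo-+ 1r a c) (×-homo-+ 1r b d) ⟩
      (a · 1r + c · 1r) + - (b · 1r + d · 1r)
        ≡⟨ cong (a · 1r + c · 1r +_) (neg-+ (b · 1r) (d · 1r)) ⟨
      (a · 1r + c · 1r) + (- (b · 1r) + - (d · 1r))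
        ≡⟨ interchange _ _ _ _ ⟩
      val (a , b) + val (c , d) ∎

    val-neg : ∀ p → val (RawRing.-_ integers p) ≡ - val p
    val-neg (a , b) = begin
      b · 1r + - (a · 1r)         ≡⟨ +-comm _ _ ⟩
      - (a · 1r) + b · 1r         ≡⟨ cong (- (a · 1r) +_) (-‿involutive (b · 1r)) ⟨
      - (a · 1r) + - - (b · 1r)   ≡⟨ neg-+ _ _ ⟩
      - val (a , b)               ∎

    foil : ∀ a b c d → (a + b) * (c + d) ≡ (a * c + b * d) + (a * d + b * c)
    foil a b c d = begin
      (a + b) * (c + d)                  ≡⟨ distribˡ (a + b) c d ⟩
      (a + b) * c + (a + b) * d          ≡⟨ cong₂ _+_ (distribʳ c a b) (distribʳ d a b) ⟩
      (a * c + b * c) + (a * d + b * d)  ≡⟨ cong (a * c + b * c +_) (+-comm _ _) ⟩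
      (a * c + b * c) + (b * d + a * d)  ≡⟨ interchange _ _ _ _ ⟩
      (a * c + b * d) + (b * c + a * d)  ≡⟨ cong (a * c + b * d +_) (+-comm _ _) ⟩
      (a * c + b * d) + (a * d + b * c)  ∎
      where open CommutativeRing commutativeRing using (distribʳ)

    val-* : ∀ p q → val (RawRing._*_ integers p q) ≡ val p * val q
    val-* (a , b) (c , d) = begin
      (a ℕ.* c ℕ.+ b ℕ.* d) · 1r + - ((a ℕ.* d ℕ.+ b ℕ.* c) · 1r)
        ≡⟨ cong₂ (λ x y → x + - y) (hom a c b d) (hom a d b c) ⟩
      (A * C + B * D) + - (A * D + B * C)
        ≡⟨ cong (A * C + B * D +_) (neg-+ _ _) ⟨
      (A * C + B * D) + (- (A * D) + - (B * C))
        ≡⟨ cong₂ (λ x y → (A * C + x) + y) (neg-neg B D) (cong₂ _+_ (-‿distribʳ-* A D) (-‿distribˡ-* B C)) ⟩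
      (A * C + - B * - D) + (A * - D + - B * C)
        ≡⟨ foil A (- B) C (- D) ⟨
      val (a , b) * val (c , d) ∎
      where
      A = a · 1r
      B = b · 1r
      C = c · 1r
      D = d · 1r
      hom : ∀ a c b d → (a ℕ.* c ℕ.+ b ℕ.* d) · 1r ≡ (a · 1r) * (c · 1r) + (b · 1r) * (d · 1r)
      hom a c b d = trans (×-homo-+ 1r (a ℕ.* c) (b ℕ.* d)) (cong₂ _+_ (×1-homo-* a c) (×1-homo-* b d))
      neg-neg : ∀ x y → x * y ≡ - x * - y
      neg-neg x y = begin
        x * y        ≡⟨ -‿involutive (x * y) ⟨
        - - (x * y)  ≡⟨ cong -_ (-‿distribʳ-* x y) ⟩
        - (x * - y)  ≡⟨ -‿distribˡ-* x (- y) ⟩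
        - x * - y    ∎

    morphism : integers ACR.-Raw-AlmostCommutative⟶ ACR.fromCommutativeRing commutativeRing
    morphism = record
      { ⟦_⟧ = val ; +-homo = val-+ ; *-homo = val-* ; -‿homo = val-neg
      ; 0-homo = trans (+-identityˡ _) -0#≈0#
      ; 1-homo = trans (cong₂ _+_ (+-identityʳ 1r) -0#≈0#) (+-identityʳ 1r) }

    -- Formal differences are not kept reduced, so equal coefficients such as (1 , 1) and (0 , 0)
    -- are recognised by cross addition.
    val-≟ : ∀ p q → Maybe (val p ≡ val q)
    val-≟ (a , b) (c , d) with a ℕ.≟ c | b ℕ.≟ d
    ... | yes refl | yes refl = just refl
    ... | _ | _ with (a ℕ.+ d) ℕ.≟ (c ℕ.+ b)
    ... | no _ = nothing
    ... | yes e = just (begin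
      A + - B                    ≡⟨ +-identityʳ _ ⟨
      (A + - B) + 0r             ≡⟨ cong ((A + - B) +_) (trans (+-comm D (- D)) (+-inverseˡ D)) ⟨
      (A + - B) + (D + - D)      ≡⟨ interchange _ _ _ _ ⟩
      (A + D) + (- B + - D)      ≡⟨ cong (_+ (- B + - D)) (trans (sym (×-homo-+ 1r a d)) (trans (cong (_· 1r) e) (×-homo-+ 1r c b))) ⟩
      (C + B) + (- B + - D)      ≡⟨ cong ((C + B) +_) (+-comm (- B) (- D)) ⟩
      (C + B) + (- D + - B)      ≡⟨ interchange _ _ _ _ ⟩
      (C + - D) + (B + - B)      ≡⟨ cong ((C + - D) +_) (trans (+-comm B (- B)) (+-inverseˡ B)) ⟩
      (C + - D) + 0r             ≡⟨ +-identityʳ _ ⟩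
      C + - D                    ∎)
      where
      A = a · 1r
      B = b · 1r
      C = c · 1r
      D = d · 1r

  open Algebra.Solver.Ring integers (ACR.fromCommutativeRing commutativeRing) morphism val-≟ public
    using (solve; _:=_; _:+_; _:*_; :-_; con)

-- Signs of real numbers

data Sign : Set where
  neg zer pos : Sign

_≟ₛ_ : DecidableEquality Sign
neg ≟ₛ neg = yes refl
neg ≟ₛ zer = no λ ()
neg ≟ₛ pos = no λ ()
zer ≟ₛ neg = no λ ()
zer ≟ₛ zer = yes refl
zer ≟ₛ pos = no λ ()
pos ≟ₛ neg = no λ ()
pos ≟ₛ zer = no λ ()
pos ≟ₛ pos = yes refl

opp : Sign → Sign
opp neg = pos
opp zer = zer
opp pos = neg

infixl 7 _⊗_
_⊗_ : Sign → Sign → Sign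
zer ⊗ _ = zer
pos ⊗ τ = τ
neg ⊗ τ = opp τ

⊗-cancelʳ : ∀ σ τ → τ ≢ zer → (σ ⊗ τ) ⊗ τ ≡ σ
⊗-cancelʳ neg neg _ = refl
⊗-cancelʳ neg pos _ = refl
⊗-cancelʳ zer _ _ = refl
⊗-cancelʳ pos neg _ = refl
⊗-cancelʳ pos pos _ = refl
⊗-cancelʳ neg zer h = contradiction refl h
⊗-cancelʳ pos zer h = contradiction refl h

module Signs (R : RealField) where
  open RealRing R public

  infixl 6 _-_
  _-_ : Carrier → Carrier → Carrier
  x - y = x + - y

  -‿inverseʳ : ∀ x → x - x ≡ 0r
  -‿inverseʳ x = trans (+-comm x (- x)) (+-inverseˡ x)

  -≡0 : ∀ {x y} → x - y ≡ 0r → x ≡ y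
  -≡0 {x} {y} e = begin
    x              ≡⟨ +-identityʳ x ⟨
    x + 0r         ≡⟨ cong (x +_) (+-inverseˡ y) ⟨
    x + (- y + y)  ≡⟨ +-assoc x (- y) y ⟨
    x - y + y      ≡⟨ cong (_+ y) e ⟩
    0r + y         ≡⟨ +-identityˡ y ⟩
    y              ∎
    where open ≡-Reasoning

  _≟_ : DecidableEquality Carrier
  x ≟ y with <-trichotomy x y
  ... | inj₁ x<y = no λ { refl → <-irrefl x x<y }
  ... | inj₂ (inj₁ x≡y) = yes x≡y
  ... | inj₂ (inj₂ y<x) = no λ { refl → <-irrefl x y<x }

  IsSign : Sign → Carrier → Set
  IsSign neg x = x < 0r
  IsSign zer x = x ≡ 0r
  IsSign pos x = 0r < x

  signed : ∀ x → ∃ λ σ → IsSign σ x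
  signed x with <-trichotomy x 0r
  ... | inj₁ x<0 = neg , x<0
  ... | inj₂ (inj₁ x≡0) = zer , x≡0
  ... | inj₂ (inj₂ 0<x) = pos , 0<x

  sgn : Carrier → Sign
  sgn x = proj₁ (signed x)

  sgn-sound : ∀ {x σ} → sgn x ≡ σ → IsSign σ x
  sgn-sound {x} refl = proj₂ (signed x)

  IsSign-unique : ∀ σ τ {x} → IsSign σ x → IsSign τ x → σ ≡ τ
  IsSign-unique neg neg _ _ = refl
  IsSign-unique zer zer _ _ = refl
  IsSign-unique pos pos _ _ = refl
  IsSign-unique neg zer p refl = contradiction p (<-irrefl 0r)
  IsSign-unique zer neg refl p = contradiction p (<-irrefl 0r)
  IsSign-unique pos zer p refl = contradiction p (<-irrefl 0r)
  IsSign-unique zer pos refl p = contradiction p (<-irrefl 0r)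
  IsSign-unique neg pos p q = contradiction (<-trans p q) (<-irrefl _)
  IsSign-unique pos neg p q = contradiction (<-trans p q) (<-irrefl _)

  sgn-complete : ∀ σ {x} → IsSign σ x → sgn x ≡ σ
  sgn-complete σ {x} p = IsSign-unique (sgn x) σ (sgn-sound refl) p

  IsSign-neg : ∀ σ {x} → IsSign σ x → IsSign (opp σ) (- x)
  IsSign-neg neg {x} p = subst₂ _<_ (-‿inverseʳ x) (+-identityˡ (- x)) (+-mono-< (- x) p)
  IsSign-neg zer refl = trans (sym (+-identityˡ _)) (-‿inverseʳ 0r)
  IsSign-neg pos {x} p = subst₂ _<_ (+-identityˡ (- x)) (-‿inverseʳ x) (+-mono-< (- x) p)

  sgn-neg : ∀ x → sgn (- x) ≡ opp (sgn x)
  sgn-neg x = sgn-complete (opp (sgn x)) (IsSign-neg (sgn x) (sgn-sound refl))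

  private
    pos-* : ∀ τ {x y} → 0r < x → IsSign τ y → IsSign τ (x * y)
    pos-* neg {x} {y} p q = subst (IsSign neg)
      (solve 2 (λ x y → :- (x :* :- y) := x :* y) refl x y)
      (IsSign-neg pos (*-pos p (IsSign-neg neg q)))
    pos-* zer {x} p refl = zeroʳ x
    pos-* pos p q = *-pos p q

    IsSign-* : ∀ σ τ {x y} → IsSign σ x → IsSign τ y → IsSign (σ ⊗ τ) (x * y)
    IsSign-* neg τ {x} {y} p q = subst (IsSign (opp τ))
      (solve 2 (λ x y → :- (:- x :* y) := x :* y) refl x y)
      (IsSign-neg τ (pos-* τ (IsSign-neg neg p) q))
    IsSign-* zer τ {y = y} refl q = zeroˡ y
    IsSign-* pos τ p q = pos-* τ p q

    IsSign-+ : ∀ σ {x y} → IsSign σ x → IsSign σ y ⊎ IsSign zer y → IsSign σ (x + y)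
    IsSign-+ σ {x} p (inj₂ refl) = subst (IsSign σ) (sym (+-identityʳ x)) p
    IsSign-+ neg {x} {y} p (inj₁ q) = <-trans (subst (x + y <_) (+-identityˡ y) (+-mono-< y p)) q
    IsSign-+ zer {x} refl (inj₁ refl) = +-identityʳ x
    IsSign-+ pos {x} {y} p (inj₁ q) = <-trans q (subst (_< x + y) (+-identityˡ y) (+-mono-< y p))

  sgn-* : ∀ x y → sgn (x * y) ≡ sgn x ⊗ sgn y
  sgn-* x y = sgn-complete _ (IsSign-* (sgn x) (sgn y) (sgn-sound refl) (sgn-sound refl))

  sgn-+ : ∀ σ {x y} → sgn x ≡ σ → sgn y ≡ σ ⊎ sgn y ≡ zer → sgn (x + y) ≡ σ
  sgn-+ σ p (inj₁ q) = sgn-complete σ (IsSign-+ σ (sgn-sound p) (inj₁ (sgn-sound q)))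
  sgn-+ σ p (inj₂ q) = sgn-complete σ (IsSign-+ σ (sgn-sound p) (inj₂ (sgn-sound q)))

  -- A nonzero sign is its own inverse, so a quotient and a product have the same sign. This turns
  -- the height of a vertex, a quotient of linear forms, into a product of two signs.
  sgn-quotient : ∀ {x y z} → y ≢ 0r → x * y ≡ z → sgn x ≡ sgn z ⊗ sgn y
  sgn-quotient {x} {y} y≢0 refl = sym (trans (cong (_⊗ sgn y) (sgn-* x y))
    (⊗-cancelʳ (sgn x) (sgn y) (λ e → y≢0 (sgn-sound e))))

  sgn-<ˡ : ∀ {x y} → x < y → sgn (x - y) ≡ neg
  sgn-<ˡ {x} {y} p = sgn-complete neg (subst (x - y <_) (-‿inverseʳ y) (+-mono-< (- y) p))

  sgn-<ʳ : ∀ {x y} → x < y → sgn (y - x) ≡ pos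
  sgn-<ʳ {x} {y} p = sgn-complete pos (subst (_< y - x) (-‿inverseʳ x) (+-mono-< (- x) p))

  *-nonzero : ∀ {x y} → x * y ≡ 0r → x ≢ 0r → y ≡ 0r
  *-nonzero {x} {y} e x≢0 with *-inverse x x≢0
  ... | x⁻¹ , xx⁻¹≡1 = begin
    y              ≡⟨ *-identityˡ y ⟨
    1r * y         ≡⟨ cong (_* y) xx⁻¹≡1 ⟨
    (x * x⁻¹) * y  ≡⟨ solve 3 (λ x i y → (x :* i) :* y := i :* (x :* y)) refl x x⁻¹ y ⟩
    x⁻¹ * (x * y)  ≡⟨ cong (x⁻¹ *_) e ⟩
    x⁻¹ * 0r       ≡⟨ zeroʳ x⁻¹ ⟩
    0r             ∎
    where open ≡-Reasoning

  infixl 7 _÷_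
  -- x ÷ 0 = 0
  _÷_ : Carrier → Carrier → Carrier
  x ÷ y with y ≟ 0r
  ... | yes _ = 0r
  ... | no y≢0 = x * proj₁ (*-inverse y y≢0)

  ÷-* : ∀ x {y} → y ≢ 0r → (x ÷ y) * y ≡ x
  ÷-* x {y} y≢0 with y ≟ 0r
  ... | yes y≡0 = contradiction y≡0 y≢0
  ... | no y≢0′ with *-inverse y y≢0′
  ... | y⁻¹ , yy⁻¹≡1 = begin
    (x * y⁻¹) * y  ≡⟨ solve 3 (λ x i y → (x :* i) :* y := (y :* i) :* x) refl x y⁻¹ y ⟩
    (y * y⁻¹) * x  ≡⟨ cong (_* x) yy⁻¹≡1 ⟩
    1r * x         ≡⟨ *-identityˡ x ⟩
    x              ∎
    where open ≡-Reasoning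

-- Linear forms and elimination of a variable

module Linear (R : RealField) where
  open Signs R public
  open ≡-Reasoning

  V : ℕ → Set
  V n = Fin n → Carrier

  sumF-cong : ∀ {n} {f g : V n} → (∀ i → f i ≡ g i) → sumF R f ≡ sumF R g
  sumF-cong {zero} e = refl
  sumF-cong {suc n} e = cong₂ _+_ (e Fin.zero) (sumF-cong (λ i → e (Fin.suc i)))

  sumF-zero : ∀ {n} {f : V n} → (∀ i → f i ≡ 0r) → sumF R f ≡ 0r
  sumF-zero {zero} e = refl
  sumF-zero {suc n} e = trans (cong₂ _+_ (e Fin.zero) (sumF-zero (λ i → e (Fin.suc i)))) (+-identityˡ 0r)

  sumF-+ : ∀ {n} (f g : V n) → sumF R (λ i → f i + g i) ≡ sumF R f + sumF R g
  sumF-+ {zero} f g = sym (+-identityˡ 0r)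
  sumF-+ {suc n} f g = trans (cong (f Fin.zero + g Fin.zero +_) (sumF-+ {n} (λ i → f (Fin.suc i)) (λ i → g (Fin.suc i))))
    (solve 4 (λ a b c d → (a :+ b) :+ (c :+ d) := (a :+ c) :+ (b :+ d)) refl _ _ _ _)

  sumF-* : ∀ {n} c (f : V n) → sumF R (λ i → c * f i) ≡ c * sumF R f
  sumF-* {zero} c f = sym (zeroʳ c)
  sumF-* {suc n} c f = trans (cong (c * f Fin.zero +_) (sumF-* {n} c (λ i → f (Fin.suc i)))) (sym (distribˡ _ _ _))

  sumF-punchIn : ∀ {n} (j : Fin (suc n)) (f : V (suc n)) → sumF R f ≡ f j + sumF R (λ i → f (punchIn j i))
  sumF-punchIn Fin.zero f = refl
  sumF-punchIn {suc n} (Fin.suc j) f = trans (cong (f Fin.zero +_) (sumF-punchIn j (λ i → f (Fin.suc i))))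
    (solve 3 (λ a b c → a :+ (b :+ c) := b :+ (a :+ c)) refl _ _ _)

  infixl 8 _∙_
  _∙_ : ∀ {n} → V n → V n → Carrier
  f ∙ x = sumF R (λ i → f i * x i)

  infixl 6 _⊕_
  infixl 9 _⊙_
  _⊕_ : ∀ {n} → V n → V n → V n
  (x ⊕ y) i = x i + y i

  _⊙_ : ∀ {n} → Carrier → V n → V n
  (c ⊙ x) i = c * x i

  ⊖_ : ∀ {n} → V n → V n
  (⊖ x) i = - x i

  ∙-cong : ∀ {n} (f : V n) {x y : V n} → (∀ i → x i ≡ y i) → f ∙ x ≡ f ∙ y
  ∙-cong f e = sumF-cong (λ i → cong (f i *_) (e i))

  ∙-comm : ∀ {n} (f x : V n) → f ∙ x ≡ x ∙ f
  ∙-comm f x = sumF-cong (λ i → *-comm (f i) (x i))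

  ∙-⊕ : ∀ {n} (f x y : V n) → f ∙ (x ⊕ y) ≡ f ∙ x + f ∙ y
  ∙-⊕ f x y = trans (sumF-cong (λ i → distribˡ (f i) (x i) (y i))) (sumF-+ (λ i → f i * x i) (λ i → f i * y i))

  ∙-⊙ : ∀ {n} (f : V n) c (x : V n) → f ∙ (c ⊙ x) ≡ c * f ∙ x
  ∙-⊙ f c x = trans (sumF-cong (λ i → solve 3 (λ a b c → a :* (b :* c) := b :* (a :* c)) refl (f i) c (x i)))
    (sumF-* c (λ i → f i * x i))

  ∙-⊖ : ∀ {n} (f x : V n) → f ∙ (⊖ x) ≡ - (f ∙ x)
  ∙-⊖ {zero} f x = sym (IsSign-neg zer refl)
  ∙-⊖ {suc n} f x = trans (cong (f Fin.zero * - x Fin.zero +_) (∙-⊖ {n} (λ i → f (Fin.suc i)) (λ i → x (Fin.suc i))))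
    (solve 3 (λ a b c → a :* :- b :+ :- c := :- (a :* b :+ c)) refl _ _ _)

  unit : ∀ {n} → Fin n → V n
  unit {suc n} Fin.zero Fin.zero = 1r
  unit {suc n} Fin.zero (Fin.suc _) = 0r
  unit {suc n} (Fin.suc _) Fin.zero = 0r
  unit {suc n} (Fin.suc i) (Fin.suc j) = unit i j

  unit-∙ : ∀ {n} (i : Fin n) (x : V n) → unit i ∙ x ≡ x i
  unit-∙ {suc n} Fin.zero x = trans (cong₂ _+_ (*-identityˡ _) (sumF-zero (λ i → zeroˡ (x (Fin.suc i))))) (+-identityʳ _)
  unit-∙ {suc n} (Fin.suc i) x = trans (cong₂ _+_ (zeroˡ _) (unit-∙ i (λ i → x (Fin.suc i)))) (+-identityˡ _)

  module Eliminate {n} (l : V (suc n)) (j : Fin (suc n)) (lⱼ≢0 : l j ≢ 0r) where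

    -- The form m restricted to the hyperplane l = 0, in the coordinates other than j: subtracting a
    -- multiple of l removes the coefficient at j.
    reduce : V (suc n) → V n
    reduce m i = m (punchIn j i) - (m j ÷ l j) * l (punchIn j i)

    reduce-∙ : ∀ m x → l ∙ x ≡ 0r → reduce m ∙ (λ i → x (punchIn j i)) ≡ m ∙ x
    reduce-∙ m x lx≡0 = begin
      reduce m ∙ x′            ≡⟨ ∙-comm (reduce m) x′ ⟩
      x′ ∙ (m′ ⊕ (⊖ (q ⊙ l′)))   ≡⟨ ∙-⊕ x′ m′ (⊖ (q ⊙ l′)) ⟩
      x′ ∙ m′ + x′ ∙ (⊖ (q ⊙ l′)) ≡⟨ cong (x′ ∙ m′ +_) (trans (∙-⊖ x′ (q ⊙ l′)) (cong -_ (∙-⊙ x′ q l′))) ⟩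
      x′ ∙ m′ - q * x′ ∙ l′      ≡⟨ +-identityʳ _ ⟨
      x′ ∙ m′ - q * x′ ∙ l′ + 0r ≡⟨ cong (x′ ∙ m′ - q * x′ ∙ l′ +_) (trans (cong (q *_) lx′≡0) (zeroʳ q)) ⟨
      x′ ∙ m′ - q * x′ ∙ l′ + q * (l j * x j + x′ ∙ l′)
        ≡⟨ solve 5 (λ a q b l x → a :+ :- (q :* b) :+ q :* (l :* x :+ b) := (q :* l) :* x :+ a) refl (x′ ∙ m′) q (x′ ∙ l′) (l j) (x j) ⟩
      (q * l j) * x j + x′ ∙ m′  ≡⟨ cong₂ (λ a b → a * x j + b) (÷-* (m j) lⱼ≢0) (∙-comm x′ m′) ⟩
      m j * x j + m′ ∙ x′        ≡⟨ sumF-punchIn j (λ i → m i * x i) ⟨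
      m ∙ x                     ∎
      where
      q = m j ÷ l j
      x′ = λ i → x (punchIn j i)
      m′ = λ i → m (punchIn j i)
      l′ = λ i → l (punchIn j i)
      lx′≡0 : l j * x j + x′ ∙ l′ ≡ 0r
      lx′≡0 = trans (cong (l j * x j +_) (∙-comm x′ l′)) (trans (sym (sumF-punchIn j (λ i → l i * x i))) lx≡0)

    -- Inverse on l = 0 of forgetting coordinate j, which is recovered from the equation.
    lift : V n → V (suc n)
    lift y = insertAt y j (- (((λ i → l (punchIn j i)) ∙ y) ÷ l j))

    lift-punchIn : ∀ y i → lift y (punchIn j i) ≡ y i
    lift-punchIn y i = insertAt-punchIn y j _ i

    lift-∙ : ∀ y → l ∙ lift y ≡ 0r
    lift-∙ y = begin
      l ∙ lift y                          ≡⟨ sumF-punchIn j (λ i → l i * lift y i) ⟩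
      l j * lift y j + l′ ∙ (λ i → lift y (punchIn j i))
        ≡⟨ cong₂ (λ a b → l j * a + b) (insertAt-lookup y j _) (∙-cong l′ (lift-punchIn y)) ⟩
      l j * - q + l′ ∙ y                    ≡⟨ cong (_+ l′ ∙ y) (solve 2 (λ a b → a :* :- b := :- (b :* a)) refl (l j) q) ⟩
      - (q * l j) + l′ ∙ y                  ≡⟨ cong (λ z → - z + l′ ∙ y) (÷-* (l′ ∙ y) lⱼ≢0) ⟩
      - (l′ ∙ y) + l′ ∙ y                   ≡⟨ +-inverseˡ _ ⟩
      0r                                   ∎
      where
      l′ = λ i → l (punchIn j i)
      q = (l′ ∙ y) ÷ l j

  zeroOrPivot : ∀ {n} (l : V n) → (∀ j → l j ≡ 0r) ⊎ ∃ λ j → l j ≢ 0r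
  zeroOrPivot l with Fin.all? (λ j → l j ≟ 0r)
  ... | yes p = inj₁ p
  ... | no ¬p = inj₂ (Fin.¬∀⟶∃¬ _ _ (λ j → l j ≟ 0r) ¬p)

  zero-∙ : ∀ {n} {l : V n} → (∀ j → l j ≡ 0r) → ∀ x → l ∙ x ≡ 0r
  zero-∙ e x = sumF-zero (λ i → trans (cong (_* x i) (e i)) (zeroˡ (x i)))

  -- Gaussian elimination: each nonzero form removes one variable, and zero forms are dropped. The
  -- number of forms is a separate argument because the recursion passes to the reduced list.
  kernel′ : ∀ k {n} (ms : List (V n)) → length ms ≡ k → k ℕ.< n →
            ∃ λ v → (∃ λ j → v j ≢ 0r) × All (λ m → m ∙ v ≡ 0r) ms
  kernel′ zero {suc n} [] _ _ = (λ _ → 1r) , (Fin.zero , λ e → 0≢1 (sym e)) , []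
  kernel′ (suc k) {suc n} (l ∷ ms) e (ℕ.s≤s k<n) with zeroOrPivot l
  ... | inj₁ l≡0 with kernel′ k ms (ℕ.suc-injective e) (ℕ.<-trans k<n (ℕ.n<1+n n))
  ...   | v , v≢0 , ms≡0 = v , v≢0 , zero-∙ l≡0 v ∷ ms≡0
  kernel′ (suc k) {suc n} (l ∷ ms) e (ℕ.s≤s k<n) | inj₂ (j , lⱼ≢0)
    with kernel′ k (map reduce ms) (trans (length-map reduce ms) (ℕ.suc-injective e)) k<n
    where open Eliminate l j lⱼ≢0
  ... | v , (i , vᵢ≢0) , ms≡0 =
    lift v , (punchIn j i , λ e → vᵢ≢0 (trans (sym (lift-punchIn v i)) e)) , lift-∙ v ∷
    All.map (λ {m} e → trans (sym (reduce-∙ m (lift v) (lift-∙ v))) (trans (∙-cong (reduce m) (lift-punchIn v)) e))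
      (All.map⁻ ms≡0)
    where open Eliminate l j lⱼ≢0

  kernel : ∀ {n} (ms : List (V n)) → length ms ℕ.< n →
           ∃ λ v → (∃ λ j → v j ≢ 0r) × All (λ m → m ∙ v ≡ 0r) ms
  kernel ms = kernel′ (length ms) ms refl

-- Counting the sign patterns of linear forms

module Patterns (R : RealField) where
  open Linear R

  signature : ∀ {n} → List (V n) → V n → List Sign
  signature ms x = map (λ m → sgn (m ∙ x)) ms

  signature-cong : ∀ {n n′} (f : V n → V n′) (ms : List (V n)) x {y} →
                   (∀ m → f m ∙ y ≡ m ∙ x) → signature (map f ms) y ≡ signature ms x
  signature-cong f ms x e = trans (sym (map-∘ ms)) (map-cong (λ m → cong sgn (e m)) ms)

  private
    -- The coefficients of a nonzero combination with nonnegative coefficients have such signs.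
    Admissible : Sign → Sign → Set
    Admissible σ τ = (σ ≡ pos × (τ ≡ pos ⊎ τ ≡ zer)) ⊎ (σ ≡ zer × τ ≡ pos)

    -- Here σ and τ are the signs of l at x and y. The points `crossing l x y` and `crossing l y x`
    -- are negatives of each other; if the signs differ, one of the two is a positive multiple of a
    -- point of the segment from x to y.
    admissible : ∀ {σ τ} → σ ≢ τ → Admissible (opp τ) σ ⊎ Admissible (opp σ) τ
    admissible {neg} {neg} h = contradiction refl h
    admissible {neg} {zer} h = inj₂ (inj₁ (refl , inj₂ refl))
    admissible {neg} {pos} h = inj₂ (inj₁ (refl , inj₁ refl))
    admissible {zer} {neg} h = inj₁ (inj₁ (refl , inj₂ refl))
    admissible {zer} {zer} h = contradiction refl h
    admissible {zer} {pos} h = inj₂ (inj₂ (refl , refl))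
    admissible {pos} {neg} h = inj₁ (inj₁ (refl , inj₁ refl))
    admissible {pos} {zer} h = inj₁ (inj₂ (refl , refl))
    admissible {pos} {pos} h = contradiction refl h

    sgn-combination : ∀ {α β x y} → Admissible (sgn α) (sgn β) → sgn x ≡ sgn y → sgn (α * x + β * y) ≡ sgn x
    sgn-combination {α} {β} {x} {y} (inj₁ (pα , pβ)) e =
      sgn-+ (sgn x) (trans (sgn-* α x) (cong (_⊗ sgn x) pα)) (rest pβ)
      where
      rest : sgn β ≡ pos ⊎ sgn β ≡ zer → sgn (β * y) ≡ sgn x ⊎ sgn (β * y) ≡ zer
      rest (inj₁ p) = inj₁ (trans (sgn-* β y) (trans (cong (_⊗ sgn y) p) (sym e)))
      rest (inj₂ p) = inj₂ (trans (sgn-* β y) (cong (_⊗ sgn y) p))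
    sgn-combination {α} {β} {x} {y} (inj₂ (pα , pβ)) e =
      trans (cong sgn (+-comm (α * x) (β * y)))
        (sgn-+ (sgn x) (trans (sgn-* β y) (trans (cong (_⊗ sgn y) pβ) (sym e)))
          (inj₂ (trans (sgn-* α x) (cong (_⊗ sgn x) pα))))

  -- Where the line through x and y crosses l = 0, up to a scalar factor.
  crossing : ∀ {n} → V n → V n → V n → V n
  crossing l x y = (- (l ∙ y)) ⊙ x ⊕ (l ∙ x) ⊙ y

  private
    ∙-combination : ∀ {n} (m : V n) α β x y → m ∙ (α ⊙ x ⊕ β ⊙ y) ≡ α * (m ∙ x) + β * (m ∙ y)
    ∙-combination m α β x y = trans (∙-⊕ m (α ⊙ x) (β ⊙ y)) (cong₂ _+_ (∙-⊙ m α x) (∙-⊙ m β y))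

  crossing-∙ : ∀ {n} (l x y : V n) → l ∙ crossing l x y ≡ 0r
  crossing-∙ l x y = trans (∙-combination l (- (l ∙ y)) (l ∙ x) x y)
    (trans (solve 2 (λ a b → :- b :* a :+ a :* b := a :* b :+ :- (a :* b)) refl (l ∙ x) (l ∙ y)) (-‿inverseʳ _))

  private
    crossing-signature : ∀ {n} (l x y : V n) ms → Admissible (opp (sgn (l ∙ y))) (sgn (l ∙ x)) →
      signature ms x ≡ signature ms y → signature ms (crossing l x y) ≡ signature ms x
    crossing-signature l x y [] adm e = refl
    crossing-signature l x y (m ∷ ms) adm e = cong₂ _∷_
      (trans (cong sgn (∙-combination m (- (l ∙ y)) (l ∙ x) x y))
        (sgn-combination (subst (λ σ → Admissible σ (sgn (l ∙ x))) (sym (sgn-neg (l ∙ y))) adm)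
          (proj₁ (∷-injective e))))
      (crossing-signature l x y ms adm (proj₂ (∷-injective e)))

    allSigns : List Sign
    allSigns = neg ∷ zer ∷ pos ∷ []

    ∈-allSigns : ∀ σ → σ ∈ allSigns
    ∈-allSigns neg = here refl
    ∈-allSigns zer = there (here refl)
    ∈-allSigns pos = there (there (here refl))

    -- The recurrence behind the base 1 + 3k: a further form adds at most 3 patterns for each
    -- pattern of the forms restricted to its kernel, and thereby 3 to the base.
    cellBound-suc : ∀ k n {p q} → p ℕ.≤ (1 ℕ.+ 3 ℕ.* k) ℕ.^ suc n → q ℕ.≤ (1 ℕ.+ 3 ℕ.* k) ℕ.^ n →
                    p ℕ.+ 3 ℕ.* q ℕ.≤ (1 ℕ.+ 3 ℕ.* suc k) ℕ.^ suc n
    cellBound-suc k n {p} {q} p≤ q≤ = begin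
      p ℕ.+ 3 ℕ.* q                     ≤⟨ ℕ.+-mono-≤ p≤ (ℕ.*-monoʳ-≤ 3 q≤) ⟩
      b ℕ.* b ℕ.^ n ℕ.+ 3 ℕ.* b ℕ.^ n   ≡⟨ ℕ.*-distribʳ-+ (b ℕ.^ n) b 3 ⟨
      (b ℕ.+ 3) ℕ.* b ℕ.^ n             ≤⟨ ℕ.*-monoʳ-≤ (b ℕ.+ 3) (ℕ.^-monoˡ-≤ n (ℕ.m≤m+n b 3)) ⟩
      (b ℕ.+ 3) ℕ.^ suc n               ≡⟨ cong (λ c → c ℕ.^ suc n) b+3 ⟩
      (1 ℕ.+ 3 ℕ.* suc k) ℕ.^ suc n     ∎
      where
      open ℕ.≤-Reasoning
      b = 1 ℕ.+ 3 ℕ.* k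
      b+3 : b ℕ.+ 3 ≡ 1 ℕ.+ 3 ℕ.* suc k
      b+3 = cong suc (trans (ℕ.+-comm (3 ℕ.* k) 3) (sym (ℕ.*-suc 3 k)))

  -- Cells are convex. If two sample points agree on `ms` but differ in the sign of l, the segment
  -- between them meets l = 0 in a point with the same pattern on `ms`. So a pattern of `ms` either
  -- extends in only one way, or it also occurs in the kernel of l, one dimension lower, and extends
  -- in at most three ways.
  patterns′ : ∀ k {n} (ms : List (V n)) → length ms ≡ k → (S : List (V n)) →
              ∃ λ ps → length ps ℕ.≤ (1 ℕ.+ 3 ℕ.* k) ℕ.^ n × (∀ {x} → x ∈ S → signature ms x ∈ ps)
  patterns′ zero {n} [] e S = ([] ∷ []) , ℕ.≤-reflexive (sym (ℕ.^-zeroˡ n)) , λ _ → here refl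
  patterns′ (suc k) {n} (l ∷ ms) e S with zeroOrPivot l | patterns′ k ms (ℕ.suc-injective e) S
  ... | inj₁ l≡0 | P , P≤ , P∋ = map (zer ∷_) P
      , ℕ.≤-trans (ℕ.≤-reflexive (length-map (zer ∷_) P))
          (ℕ.≤-trans P≤ (ℕ.^-monoˡ-≤ n (ℕ.s≤s (ℕ.*-monoʳ-≤ 3 (ℕ.n≤1+n k)))))
      , λ {x} x∈S → subst (λ σ → (σ ∷ signature ms x) ∈ _)
          (sym (sgn-complete zer (zero-∙ l≡0 x))) (∈-map⁺ (zer ∷_) (P∋ x∈S))
  patterns′ (suc k) {suc n} (l ∷ ms) e S | inj₂ (j , lⱼ≢0) | P , P≤ , P∋
    with patterns′ k (map (Eliminate.reduce l j lⱼ≢0) ms) (trans (length-map _ ms) (ℕ.suc-injective e))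
           -- The sample in the kernel: the crossings of all pairs of sample points, in the
           -- coordinates other than j.
           (cartesianProductWith (λ x y i → crossing l x y (punchIn j i)) S S)
  ... | Q , Q≤ , Q∋ = ps , ps≤ , ps∋
    where
    open Eliminate l j lⱼ≢0

    Q∋crossing : ∀ {x y} → x ∈ S → y ∈ S → signature ms (crossing l x y) ∈ Q
    Q∋crossing {x} {y} x∈S y∈S = subst (_∈ Q)
      (signature-cong reduce ms (crossing l x y) (λ m → reduce-∙ m (crossing l x y) (crossing-∙ l x y)))
      (Q∋ (∈-cartesianProductWith⁺ _ x∈S y∈S))

    -- The sign of l at one sample point with pattern p; `zer` is a default for patterns that do not
    -- occur.
    choice : List Sign → Sign
    choice p with any? (λ x → ≡-dec _≟ₛ_ (signature ms x) p) S
    ... | yes any = sgn (l ∙ proj₁ (find any))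
    ... | no _ = zer

    ps = map (λ p → choice p ∷ p) P ++ cartesianProductWith _∷_ allSigns Q

    ps≤ : length ps ℕ.≤ (1 ℕ.+ 3 ℕ.* suc k) ℕ.^ suc n
    ps≤ = ℕ.≤-trans (ℕ.≤-reflexive len) (cellBound-suc k n P≤ Q≤)
      where
      len : length ps ≡ length P ℕ.+ 3 ℕ.* length Q
      len = trans (length-++ (map (λ p → choice p ∷ p) P)) (cong₂ ℕ._+_ (length-map _ P)
        (trans (length-++ (map (neg ∷_) Q)) (cong₂ ℕ._+_ (length-map _ Q)
        (trans (length-++ (map (zer ∷_) Q)) (cong₂ ℕ._+_ (length-map _ Q)
        (trans (length-++ (map (pos ∷_) Q)) (cong (ℕ._+ 0) (length-map _ Q))))))))

    choice-or-crossing : ∀ {x} → x ∈ S → sgn (l ∙ x) ≡ choice (signature ms x) ⊎ signature ms x ∈ Q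
    choice-or-crossing {x} x∈S with any? (λ y → ≡-dec _≟ₛ_ (signature ms y) (signature ms x)) S
    ... | no ¬any = contradiction (lose x∈S refl) ¬any
      where open import Data.List.Membership.Propositional using (lose)
    ... | yes any with find any
    ... | y , y∈S , same with sgn (l ∙ x) ≟ₛ sgn (l ∙ y)
    ... | yes e = inj₁ e
    ... | no x≢y with admissible x≢y
    ... | inj₁ adm = inj₂ (subst (_∈ Q) (crossing-signature l x y ms adm (sym same)) (Q∋crossing x∈S y∈S))
    ... | inj₂ adm = inj₂ (subst (_∈ Q) (trans (crossing-signature l y x ms adm same) same) (Q∋crossing y∈S x∈S))

    ps∋ : ∀ {x} → x ∈ S → signature (l ∷ ms) x ∈ ps
    ps∋ {x} x∈S with choice-or-crossing x∈S
    ... | inj₁ e = ∈-++⁺ˡ (subst (λ σ → (σ ∷ signature ms x) ∈ map (λ p → choice p ∷ p) P) (sym e)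
                     (∈-map⁺ (λ p → choice p ∷ p) (P∋ x∈S)))
    ... | inj₂ q = ∈-++⁺ʳ (map (λ p → choice p ∷ p) P)
                     (∈-cartesianProductWith⁺ _∷_ (∈-allSigns (sgn (l ∙ x))) q)

  patterns : ∀ {n} (ms : List (V n)) (S : List (V n)) →
             ∃ λ ps → length ps ℕ.≤ (1 ℕ.+ 3 ℕ.* length ms) ℕ.^ n × (∀ {x} → x ∈ S → signature ms x ∈ ps)
  patterns ms S = patterns′ (length ms) ms refl S

-- Subsets as increasing lists and their vertices

Increasing : ∀ {N} → List (Fin N) → Set
Increasing = AllPairs Fin._<_

lookup-increasing : ∀ {N} {t : List (Fin N)} → Increasing t → ∀ i j → i Fin.< j → lookup t i Fin.< lookup t j
lookup-increasing (x<t ∷ _) Fin.zero (Fin.suc j) _ = All.lookup x<t (∈-lookup j)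
lookup-increasing (_ ∷ inc) (Fin.suc i) (Fin.suc j) (ℕ.s≤s i<j) = lookup-increasing inc i j i<j

lookup⇒All : ∀ {a} {A : Set a} {P : A → Set} (t : List A) → (∀ i → P (lookup t i)) → All P t
lookup⇒All {P = P} t p = All.tabulate λ x∈t → subst P (sym (lookup-index x∈t)) (p (index x∈t))

Meets : (R : RealField) → ∀ {d N} → (Fin N → Hyperplane R d) → List (Fin N) → Point R d → Set
Meets R H t x = All (λ i → OnHyperplane R (H i) x) t

module _ (R : RealField) {d N} (H : Fin N → Hyperplane R d) (gp : GeneralPosition R H) where

  vertex : ∀ {t} → Increasing t → length t ≡ d →
           ∃ λ x → Meets R H t x × (∀ y → Meets R H t y → y ≡ x)
  vertex {t} inc refl with proj₁ gp (lookup t) (lookup-increasing inc)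
  ... | x , on , unique = x , lookup⇒All t on , λ y y∈ → unique y λ i → All.lookup y∈ (∈-lookup i)

  vertex-head : ∀ {a b s t} →
    Increasing (a ∷ s) → Increasing (b ∷ t) → length (a ∷ s) ≡ d → length (b ∷ t) ≡ d →
    ∀ x → Meets R H (a ∷ s) x → Meets R H (b ∷ t) x → a ≡ b
  vertex-head {a} {b} {s} {t} incₛ incₜ refl e x xₛ xₜ =
    proj₂ gp (lookup (a ∷ s)) (λ i → lookup (b ∷ t) (Fin.cast (sym e) i)) (lookup-increasing incₛ)
      (λ i j i<j → lookup-increasing incₜ _ _ (subst₂ ℕ._<_ (sym (Fin.toℕ-cast (sym e) i)) (sym (Fin.toℕ-cast (sym e) j)) i<j))
      x x (λ i → All.lookup xₛ (∈-lookup i)) (λ i → All.lookup xₜ (∈-lookup (Fin.cast (sym e) i))) refl Fin.zero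

-- The coloring and its description by linear forms

module Arrangement (R : RealField) {k N} (H : Fin N → Hyperplane R (suc k)) (gp : GeneralPosition R H) where
  open Linear R
  open Patterns R
  open Hyperplane
  open ≡-Reasoning

  last : V (suc k) → Carrier
  last x = x (fromℕ k)

  Good : List (Fin N) → Set
  Good t = Increasing t × length t ≡ suc k

  good? : ∀ t → Dec (Good t)
  good? t = allPairs? Fin._<?_ t ×-dec (length t ℕ.≟ suc k)

  color : List (Fin N) → Sign
  color t with good? t
  ... | yes (inc , len) = sgn (last (proj₁ (vertex R H gp inc len)))
  -- A default value; the lemmas that evaluate `color` assume `Good`.
  ... | no _ = zer

  color-vertex : ∀ {t} x → Good t → Meets R H t x → color t ≡ sgn (last x)
  color-vertex {t} x g x∈ with good? t
  ... | no ¬g = contradiction g ¬g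
  ... | yes (inc , len) = cong (λ y → sgn (last y)) (sym (proj₂ (proj₂ (vertex R H gp inc len)) x x∈))

  nrm : Fin N → V (suc k)
  nrm i = normal (H i)

  off : Fin N → Carrier
  off i = offset (H i)

  Parallel : List (Fin N) → V (suc k) → Set
  Parallel t v = All (λ i → nrm i ∙ v ≡ 0r) t

  -- General position makes the d normals independent: for the vertex x, the point x + v would be a
  -- second common point.
  parallel-zero : ∀ {t} v → Good t → Parallel t v → ∀ j → v j ≡ 0r
  parallel-zero {t} v (inc , len) v∥ j with vertex R H gp inc len
  ... | x , x∈ , unique = begin
    v j                  ≡⟨ +-identityˡ (v j) ⟨
    0r + v j             ≡⟨ cong (_+ v j) (+-inverseˡ (x j)) ⟨
    - x j + x j + v j    ≡⟨ +-assoc _ _ _ ⟩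
    - x j + (x j + v j)  ≡⟨ cong (λ y → - x j + y j) (unique (x ⊕ v) (All.zipWith on (x∈ , v∥))) ⟩
    - x j + x j          ≡⟨ +-inverseˡ (x j) ⟩
    0r                   ∎
    where
    on : ∀ {i} → OnHyperplane R (H i) x × nrm i ∙ v ≡ 0r → OnHyperplane R (H i) (x ⊕ v)
    on {i} (e , e′) = trans (∙-⊕ (nrm i) x v) (trans (cong₂ _+_ e e′) (+-identityʳ _))

  ∙-difference : ∀ f (x y : V (suc k)) → f ∙ (y ⊕ ⊖ x) ≡ f ∙ y - f ∙ x
  ∙-difference f x y = trans (∙-⊕ f y (⊖ x)) (cong (f ∙ y +_) (∙-⊖ f x))

  difference-parallel : ∀ {t} x y → Meets R H t x → Meets R H t y → Parallel t (y ⊕ ⊖ x)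
  difference-parallel x y x∈ y∈ = All.zipWith
    (λ {i} (e , e′) → trans (∙-difference (nrm i) x y) (trans (cong₂ _-_ e′ e) (-‿inverseʳ _))) (x∈ , y∈)

  parallel-⊙ : ∀ {t} c v → Parallel t v → Parallel t (c ⊙ v)
  parallel-⊙ c v = All.map (λ {i} e → trans (∙-⊙ (nrm i) c v) (trans (cong (c *_) e) (zeroʳ c)))

  parallel-- : ∀ {t} v w → Parallel t v → Parallel t w → Parallel t (v ⊕ ⊖ w)
  parallel-- v w v∥ w∥ = All.zipWith
    (λ {i} (e , e′) → trans (∙-difference (nrm i) w v) (trans (cong₂ _-_ e e′) (-‿inverseʳ 0r))) (v∥ , w∥)

  parallel-++ : ∀ s {t} v → Parallel (s ++ t) v → ∀ {q} → nrm q ∙ v ≡ 0r → Parallel (s ++ q ∷ t) v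
  parallel-++ s v st q = All.++⁺ (All.++⁻ˡ s st) (q ∷ All.++⁻ʳ s st)

  meets-++ : ∀ s {q t} x → Meets R H (s ++ q ∷ t) x → Meets R H (s ++ t) x × OnHyperplane R (H q) x
  meets-++ s x x∈ with All.++⁻ʳ s x∈
  ... | q ∷ t = All.++⁺ (All.++⁻ˡ s x∈) t , q

  -- A hyperplane as a point (b, a) of ℝ^(d+1), the space in which sign patterns are counted.
  coefficients : Fin N → V (suc (suc k))
  coefficients i Fin.zero = off i
  coefficients i (Fin.suc j) = nrm i j

  cons : Carrier → V (suc k) → V (suc (suc k))
  cons c v Fin.zero = c
  cons c v (Fin.suc j) = v j

  -- Along the line x₀ + t v cut out by s ++ t, the hyperplane a · x = b is met at
  -- t = (b - a · x₀) / (a · v).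
  module Line (s t : List (Fin N)) (q₀ : Fin N) (g₀ : Good (s ++ q₀ ∷ t)) where
    private
      len : length (map nrm (s ++ t)) ℕ.< suc k
      len = ℕ.s≤s (ℕ.≤-reflexive (trans (length-map nrm (s ++ t)) (ℕ.suc-injective (trans
        (trans (cong suc (length-++ s)) (trans (sym (ℕ.+-suc (length s) (length t))) (sym (length-++ s)))) (proj₂ g₀)))))
      ker = kernel (map nrm (s ++ t)) len
      v = proj₁ ker
      j = proj₁ (proj₁ (proj₂ ker))
      x₀ = proj₁ (vertex R H gp (proj₁ g₀) (proj₂ g₀))
      x₀∈ = proj₁ (proj₂ (vertex R H gp (proj₁ g₀) (proj₂ g₀)))

      v≢0 : v j ≢ 0r
      v≢0 = proj₂ (proj₁ (proj₂ ker))

      v∥ : Parallel (s ++ t) v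
      v∥ = All.map⁻ (proj₂ (proj₂ ker))

      transversal : ∀ {q} → Good (s ++ q ∷ t) → nrm q ∙ v ≢ 0r
      transversal g e = v≢0 (parallel-zero v g (parallel-++ s v v∥ e) j)

      param : V (suc k) → Carrier
      param y = (nrm q₀ ∙ (y ⊕ ⊖ x₀)) ÷ (nrm q₀ ∙ v)

      -- The difference of the two sides is parallel to `s ++ t`, and by the choice of `param` also
      -- to `q₀`. These are d hyperplanes in general position, so it vanishes.
      on-line : ∀ y → Meets R H (s ++ t) y → ∀ i → y i - x₀ i ≡ param y * v i
      on-line y y∈ i = -≡0 (parallel-zero ((y ⊕ ⊖ x₀) ⊕ ⊖ (param y ⊙ v)) g₀ (parallel-++ s ((y ⊕ ⊖ x₀) ⊕ ⊖ (param y ⊙ v))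
        (parallel-- (y ⊕ ⊖ x₀) (param y ⊙ v)
          (difference-parallel x₀ y (proj₁ (meets-++ s x₀ x₀∈)) y∈) (parallel-⊙ (param y) v v∥))
        {q₀} (begin
          nrm q₀ ∙ ((y ⊕ ⊖ x₀) ⊕ ⊖ (param y ⊙ v))
            ≡⟨ ∙-difference (nrm q₀) (param y ⊙ v) (y ⊕ ⊖ x₀) ⟩
          nrm q₀ ∙ (y ⊕ ⊖ x₀) - nrm q₀ ∙ (param y ⊙ v)
            ≡⟨ cong (λ z → nrm q₀ ∙ (y ⊕ ⊖ x₀) - z) (trans (∙-⊙ (nrm q₀) (param y) v) (÷-* _ (transversal g₀))) ⟩
          nrm q₀ ∙ (y ⊕ ⊖ x₀) - nrm q₀ ∙ (y ⊕ ⊖ x₀)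
            ≡⟨ -‿inverseʳ _ ⟩
          0r ∎)) i)

    denominator : V (suc (suc k))
    denominator = cons 0r v

    -- With l the last coordinate, the height l(x₀) + t l(v) at t = (b - a · x₀) / (a · v),
    -- multiplied by a · v, is l(v) b + l(x₀) (a · v) - l(v) (a · x₀). This is linear in (b, a).
    numerator : V (suc (suc k))
    numerator = cons (last v) (last x₀ ⊙ v ⊕ ⊖ (last v ⊙ x₀))

    private
      denominator-∙ : ∀ q → denominator ∙ coefficients q ≡ nrm q ∙ v
      denominator-∙ q = trans (cong₂ _+_ (zeroˡ (off q)) (∙-comm v (nrm q))) (+-identityˡ _)

      numerator-∙ : ∀ q → numerator ∙ coefficients q ≡ last v * off q + (last x₀ * nrm q ∙ v - last v * nrm q ∙ x₀)
      numerator-∙ q = cong (last v * off q +_) (begin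
        (last x₀ ⊙ v ⊕ ⊖ (last v ⊙ x₀)) ∙ nrm q            ≡⟨ ∙-comm (last x₀ ⊙ v ⊕ ⊖ (last v ⊙ x₀)) (nrm q) ⟩
        nrm q ∙ (last x₀ ⊙ v ⊕ ⊖ (last v ⊙ x₀))            ≡⟨ ∙-difference (nrm q) (last v ⊙ x₀) (last x₀ ⊙ v) ⟩
        nrm q ∙ (last x₀ ⊙ v) - nrm q ∙ (last v ⊙ x₀)      ≡⟨ cong₂ _-_ (∙-⊙ (nrm q) _ v) (∙-⊙ (nrm q) _ x₀) ⟩
        last x₀ * nrm q ∙ v - last v * nrm q ∙ x₀          ∎)

    color-sgn : ∀ {q} → Good (s ++ q ∷ t) →
                color (s ++ q ∷ t) ≡ sgn (numerator ∙ coefficients q) ⊗ sgn (denominator ∙ coefficients q)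
    color-sgn {q} g = trans (color-vertex y g y∈)
      (sgn-quotient (λ e → transversal g (trans (sym (denominator-∙ q)) e)) (begin
        last y * denominator ∙ coefficients q   ≡⟨ cong (last y *_) (denominator-∙ q) ⟩
        last y * a                              ≡⟨ cong (_* a) last-y ⟩
        (last x₀ + param y * last v) * a
          ≡⟨ solve 4 (λ x p l a → (x :+ p :* l) :* a := l :* (p :* a) :+ x :* a) refl (last x₀) (param y) (last v) a ⟩
        last v * (param y * a) + last x₀ * a     ≡⟨ cong (λ z → last v * z + last x₀ * a) pa ⟩
        last v * (off q - nrm q ∙ x₀) + last x₀ * a
          ≡⟨ solve 5 (λ l b c x a → l :* (b :+ :- c) :+ x :* a := l :* b :+ (x :* a :+ :- (l :* c))) refl (last v) (off q) (nrm q ∙ x₀) (last x₀) a ⟩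
        last v * off q + (last x₀ * a - last v * nrm q ∙ x₀) ≡⟨ numerator-∙ q ⟨
        numerator ∙ coefficients q              ∎))
      where
      y = proj₁ (vertex R H gp (proj₁ g) (proj₂ g))
      y∈ = proj₁ (proj₂ (vertex R H gp (proj₁ g) (proj₂ g)))
      a = nrm q ∙ v

      last-y : last y ≡ last x₀ + param y * last v
      last-y = trans (sym (trans (cong (last x₀ +_) (sym (on-line y (proj₁ (meets-++ s y y∈)) (fromℕ k))))
        (trans (solve 2 (λ x y → x :+ (y :+ :- x) := y :+ (x :+ :- x)) refl (last x₀) (last y))
          (trans (cong (last y +_) (-‿inverseʳ _)) (+-identityʳ _))))) refl

      pa : param y * a ≡ off q - nrm q ∙ x₀
      pa = begin
        param y * nrm q ∙ v       ≡⟨ ∙-⊙ (nrm q) (param y) v ⟨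
        nrm q ∙ (param y ⊙ v)     ≡⟨ ∙-cong (nrm q) (on-line y (proj₁ (meets-++ s y y∈))) ⟨
        nrm q ∙ (y ⊕ ⊖ x₀)        ≡⟨ ∙-difference (nrm q) x₀ y ⟩
        nrm q ∙ y - nrm q ∙ x₀    ≡⟨ cong (_- nrm q ∙ x₀) (proj₂ (meets-++ s y y∈)) ⟩
        off q - nrm q ∙ x₀        ∎

  private
    decode : List Sign → List Sign
    decode (σ ∷ τ ∷ ps) = σ ⊗ τ ∷ decode ps
    decode _ = []

    -- Two forms for each `s`, listed in the order that `decode` expects. They must serve all q at
    -- once, so the base point of each line is taken on one reference hyperplane `q₀`.
    forms : ∀ q₀ t ss → (∀ {s} → s ∈ ss → Good (s ++ q₀ ∷ t)) →
            ∃ λ ms → length ms ≡ 2 ℕ.* length ss ×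
              (∀ q → (∀ {s} → s ∈ ss → Good (s ++ q ∷ t)) →
                map (λ s → color (s ++ q ∷ t)) ss ≡ decode (signature ms (coefficients q)))
    forms q₀ t [] g₀ = [] , refl , λ _ _ → refl
    forms q₀ t (s ∷ ss) g₀ with forms q₀ t ss (λ h → g₀ (there h))
    ... | ms , len , correct = numerator ∷ denominator ∷ ms
        , trans (cong (λ n → suc (suc n)) len) (sym (ℕ.*-suc 2 (length ss)))
        , λ q g → cong₂ _∷_ (color-sgn (g (here refl))) (correct q (λ h → g (there h)))
      where open Line s t q₀ (g₀ (here refl))

  -- The 6 is the 3 of the pattern bound times two forms per tuple; the exponent is the number d + 1
  -- of coefficients of a hyperplane.
  colorPatterns : ∀ ss S t → (∀ {s q} → s ∈ ss → q ∈ S → Good (s ++ q ∷ t)) →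
    ∃ λ ps → length ps ℕ.≤ (1 ℕ.+ 6 ℕ.* length ss) ℕ.^ suc (suc k) ×
      (∀ {q} → q ∈ S → map (λ s → color (s ++ q ∷ t)) ss ∈ ps)
  colorPatterns ss [] t good = [] , ℕ.z≤n , λ ()
  colorPatterns ss (q₀ ∷ S) t good with forms q₀ t ss (λ h → good h (here refl))
  ... | ms , len , correct with patterns ms (map coefficients (q₀ ∷ S))
  ... | ps , ps≤ , ps∋ = map decode ps
      , ℕ.≤-trans (ℕ.≤-reflexive (length-map decode ps)) (subst (λ n → length ps ℕ.≤ suc n ℕ.^ suc (suc k))
          (trans (cong (3 ℕ.*_) len) (sym (ℕ.*-assoc 3 2 (length ss)))) ps≤)
      , λ {q} q∈ → subst (_∈ map decode ps) (sym (correct q (λ h → good h q∈))) (∈-map⁺ decode (ps∋ (∈-map⁺ coefficients q∈)))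
    where open import Data.List.Membership.Propositional.Properties using (∈-map⁺)

-- Pigeonhole, Mirsky's theorem and the Erdős-Rado argument

module Combinatorics where
  open import Data.Nat using (_+_; _*_; _^_; _≤_; _<_; _<?_; _≤?_)

  module _ {A : Set} where

    length-filter-¬ : ∀ {P : A → Set} (P? : Unary.Decidable P) xs →
                      length (filter P? xs) + length (filter (¬? ∘ P?) xs) ≡ length xs
    length-filter-¬ P? [] = refl
    length-filter-¬ P? (x ∷ xs) with P? x
    ... | yes _ = cong suc (length-filter-¬ P? xs)
    ... | no _ = trans (ℕ.+-suc _ _) (cong suc (length-filter-¬ P? xs))

    pigeonhole : ∀ {B : Set} (_≟_ : DecidableEquality B) (f : A → B) ps k S → (∀ {x} → x ∈ S → f x ∈ ps) →
      length ps * k < length S → ∃ λ T → T ⊆ S × k < length T × (∀ {x y} → x ∈ T → y ∈ T → f x ≡ f y)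
    pigeonhole _≟_ f [] k (x ∷ S) f∈ _ with () ← f∈ (here refl)
    pigeonhole _≟_ f (p ∷ ps) k S f∈ len with k <? length (filter (λ x → f x ≟ p) S)
    ... | yes k< = filter (λ x → f x ≟ p) S , filter-⊆ _ S , k< , λ x∈ y∈ → trans (fx≡p x∈) (sym (fx≡p y∈))
      where
      fx≡p : ∀ {x} → x ∈ filter (λ x → f x ≟ p) S → f x ≡ p
      fx≡p x∈ = proj₂ (∈-filter⁻ (λ x → f x ≟ p) {xs = S} x∈)
    ... | no k≮ with pigeonhole _≟_ f ps k S′ f∈ps
                       (ℕ.+-cancelˡ-< k (length ps * k) (length S′) (ℕ.<-≤-trans len (ℕ.≤-trans
                         (ℕ.≤-reflexive (sym (length-filter-¬ (λ x → f x ≟ p) S)))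
                         (ℕ.+-monoˡ-≤ (length S′) (ℕ.≮⇒≥ k≮)))))
      where
      S′ = filter (¬? ∘ λ x → f x ≟ p) S
      f∈ps : ∀ {x} → x ∈ S′ → f x ∈ ps
      f∈ps x∈ with ∈-filter⁻ (¬? ∘ λ x → f x ≟ p) {xs = S} x∈
      ... | x∈S , fx≢p with f∈ x∈S
      ... | here fx≡p = contradiction fx≡p fx≢p
      ... | there h = h
    ... | T , T⊆ , k< , const = T , ⊆-trans T⊆ (filter-⊆ _ S) , k< , const

    combinations : ℕ → List A → List (List A)
    combinations zero _ = [] ∷ []
    combinations (suc r) [] = []
    combinations (suc r) (x ∷ xs) = map (x ∷_) (combinations r xs) ++ combinations (suc r) xs

    ∈-combinations⁺ : ∀ {s xs} → s ⊆ xs → s ∈ combinations (length s) xs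
    ∈-combinations⁺ [] = here refl
    ∈-combinations⁺ {[]} (_ ∷ʳ _) = here refl
    ∈-combinations⁺ {_ ∷ _} (x ∷ʳ sub) = ∈-++⁺ʳ (map (x ∷_) _) (∈-combinations⁺ sub)
    ∈-combinations⁺ (refl ∷ sub) = ∈-++⁺ˡ (∈-map⁺ _ (∈-combinations⁺ sub))

    ∈-combinations⁻ : ∀ r xs {s} → s ∈ combinations r xs → s ⊆ xs × length s ≡ r
    ∈-combinations⁻ zero xs (here refl) = minimum xs , refl
    ∈-combinations⁻ (suc r) (x ∷ xs) s∈ with ∈-++⁻ (map (x ∷_) (combinations r xs)) s∈
    ... | inj₂ h = let sub , len = ∈-combinations⁻ (suc r) xs h in x ∷ʳ sub , len
    ... | inj₁ h with ∈-map⁻ (x ∷_) h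
    ... | s , s∈′ , refl = let sub , len = ∈-combinations⁻ r xs s∈′ in refl ∷ sub , cong suc len

    length-combinations : ∀ r xs → length (combinations r xs) ≤ length xs ^ r
    length-combinations zero xs = ℕ.≤-refl
    length-combinations (suc r) [] = z≤n
    length-combinations (suc r) (x ∷ xs) = begin
      length (map (x ∷_) (combinations r xs) ++ combinations (suc r) xs)
        ≡⟨ trans (length-++ (map (x ∷_) (combinations r xs))) (cong (_+ length (combinations (suc r) xs)) (length-map _ (combinations r xs))) ⟩
      length (combinations r xs) + length (combinations (suc r) xs)
        ≤⟨ ℕ.+-mono-≤ (length-combinations r xs) (length-combinations (suc r) xs) ⟩
      suc (length xs) * length xs ^ r
        ≤⟨ ℕ.*-monoʳ-≤ (suc (length xs)) (ℕ.^-monoˡ-≤ r (ℕ.n≤1+n (length xs))) ⟩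
      suc (length xs) ^ suc r ∎
      where open ℕ.≤-Reasoning

    map-≡-∈ : ∀ {B : Set} {f g : A → B} {xs x} → map f xs ≡ map g xs → x ∈ xs → f x ≡ g x
    map-≡-∈ e (here refl) = proj₁ (∷-injective e)
    map-≡-∈ e (there x∈) = map-≡-∈ (proj₂ (∷-injective e)) x∈

    -- Chains grow in the order ≺, yet must remain sublists of S, whose order is a different one.
    insert : ∀ {S T : List A} {y} → y ∈ S → ¬ y ∈ T → T ⊆ S →
      ∃ λ T′ → T′ ⊆ S × length T′ ≡ suc (length T) × (∀ {x} → x ∈ T′ → x ≡ y ⊎ x ∈ T)
    insert (here refl) y∉T (_ ∷ʳ sub) = _ , refl ∷ sub , refl , λ { (here e) → inj₁ e ; (there h) → inj₂ h }
    insert (here refl) y∉T (refl ∷ sub) = contradiction (here refl) y∉T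
    insert (there y∈S) y∉T (z ∷ʳ sub) with insert y∈S y∉T sub
    ... | T′ , sub′ , len , mem = T′ , z ∷ʳ sub′ , len , mem
    insert (there y∈S) y∉T (refl ∷ sub) with insert y∈S (y∉T ∘ there) sub
    ... | T′ , sub′ , len , mem = _ ∷ T′ , refl ∷ sub′ , cong suc len , mem′
      where
      mem′ : ∀ {x} → x ∈ _ ∷ T′ → _ ⊎ x ∈ _
      mem′ (here e) = inj₂ (here e)
      mem′ (there h) with mem h
      ... | inj₁ e = inj₁ e
      ... | inj₂ h′ = inj₂ (there h′)

    module Mirsky (_≺_ : A → A → Set) (_≺?_ : Decidable _≺_)
                  (≺-trans : ∀ {x y z} → x ≺ y → y ≺ z → x ≺ z) (≺-irrefl : ∀ {x} → ¬ x ≺ x) where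

      Antichain : List A → Set
      Antichain T = ∀ {x y} → x ∈ T → y ∈ T → ¬ x ≺ y

      Chain : List A → Set
      Chain T = ∀ {x y} → x ∈ T → y ∈ T → x ≡ y ⊎ x ≺ y ⊎ y ≺ x

      private
        minimal? : ∀ S → Unary.Decidable (λ x → ¬ ∃ λ y → y ∈ S × y ≺ x)
        minimal? S x with any? (λ y → y ≺? x) S
        ... | yes p = no λ ¬p → ¬p (find p)
        ... | no ¬p = yes λ { (y , y∈ , y≺x) → ¬p (lose y∈ y≺x) }

      -- The minimal elements form an antichain. If they are fewer than k, they are removed and the
      -- rest is treated with p - 1; a chain found there starts at a non-minimal x and is extended
      -- by some y ≺ x. This is why the least element of the chain is part of the result.
      chain-or-antichain′ : ∀ k p S → p * k < length S →
        (∃ λ T → T ⊆ S × k ≤ length T × Antichain T) ⊎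
        (∃₂ λ T x → T ⊆ S × length T ≡ suc p × Chain T × x ∈ S × (∀ {y} → y ∈ T → y ≡ x ⊎ x ≺ y))
      chain-or-antichain′ k zero (x ∷ S) _ = inj₂ ([ x ] , x , refl ∷ minimum S , refl
        , (λ { (here refl) (here refl) → inj₁ refl }) , here refl , λ { (here e) → inj₁ e })
      chain-or-antichain′ k (suc p) S len with k ≤? length (filter (minimal? S) S)
      ... | yes k≤ = inj₁ (filter (minimal? S) S , filter-⊆ _ S , k≤ , λ x∈ y∈ x≺y →
            proj₂ (∈-filter⁻ (minimal? S) {xs = S} y∈) (_ , proj₁ (∈-filter⁻ (minimal? S) {xs = S} x∈) , x≺y))
      ... | no k≰ with chain-or-antichain′ k p rest (ℕ.+-cancelˡ-< k (p * k) (length rest) (ℕ.<-≤-trans len (ℕ.≤-trans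
                         (ℕ.≤-reflexive (sym (length-filter-¬ (minimal? S) S)))
                         (ℕ.+-monoˡ-≤ (length rest) (ℕ.<⇒≤ (ℕ.≰⇒> k≰))))))
        where rest = filter (¬? ∘ minimal? S) S
      ... | inj₁ (T , T⊆ , k≤ , anti) = inj₁ (T , ⊆-trans T⊆ (filter-⊆ _ S) , k≤ , anti)
      ... | inj₂ (T , x , T⊆ , lenT , chain , x∈ , x≼) with any? (λ y → y ≺? x) S
      ... | no none = contradiction (λ { (y , y∈ , y≺x) → none (lose y∈ y≺x) })
                        (proj₂ (∈-filter⁻ (¬? ∘ minimal? S) {xs = S} x∈))
      ... | yes some with find some
      ... | y , y∈S , y≺x with insert y∈S (λ y∈T → ≺-irrefl (y≺ y∈T)) (⊆-trans T⊆ (filter-⊆ _ S))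
        where
        y≺ : ∀ {z} → z ∈ T → y ≺ z
        y≺ z∈ with x≼ z∈
        ... | inj₁ refl = y≺x
        ... | inj₂ x≺z = ≺-trans y≺x x≺z
      ... | T′ , T′⊆ , lenT′ , mem = inj₂ (T′ , y , T′⊆ , trans lenT′ (cong suc lenT) , chain′ , y∈S , y≼)
        where
        y≺ : ∀ {z} → z ∈ T → y ≺ z
        y≺ z∈ with x≼ z∈
        ... | inj₁ refl = y≺x
        ... | inj₂ x≺z = ≺-trans y≺x x≺z
        y≼ : ∀ {z} → z ∈ T′ → z ≡ y ⊎ y ≺ z
        y≼ z∈ with mem z∈
        ... | inj₁ e = inj₁ e
        ... | inj₂ z∈T = inj₂ (y≺ z∈T)
        chain′ : Chain T′
        chain′ u∈ v∈ with mem u∈ | mem v∈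
        ... | inj₁ refl | inj₁ refl = inj₁ refl
        ... | inj₁ refl | inj₂ v∈T = inj₂ (inj₁ (y≺ v∈T))
        ... | inj₂ u∈T | inj₁ refl = inj₂ (inj₂ (y≺ u∈T))
        ... | inj₂ u∈T | inj₂ v∈T = chain u∈T v∈T

      chain-or-antichain : ∀ k p S → p * k < length S →
        (∃ λ T → T ⊆ S × length T ≡ suc p × Chain T) ⊎ (∃ λ T → T ⊆ S × k ≤ length T × Antichain T)
      chain-or-antichain k p S len with chain-or-antichain′ k p S len
      ... | inj₁ anti = inj₂ anti
      ... | inj₂ (T , _ , T⊆ , lenT , chain , _) = inj₁ (T , T⊆ , lenT , chain)

  classes : ℕ → ℕ → ℕ → ℕ
  classes D r M = (1 + 6 * M ^ r) ^ D

  -- With M the previous bound, M rounds of thinning leave M + 1 points, the last of which is then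
  -- fixed. A round divides by the number of patterns, and the `suc` on `classes` pays for the point
  -- set aside in that round. The outer `suc` gives the strict inequality at the start.
  ramseyBound : ℕ → ℕ → ℕ → ℕ
  ramseyBound D base zero = base
  ramseyBound D base (suc i) = suc (suc (classes D (2 + i) (ramseyBound D base i)) ^ ramseyBound D base i)

  module ErdősRado {A : Set} (color : List A → Sign) (_≟ₛ_ : DecidableEquality Sign) (xs : List A) (d D : ℕ)
    (patterns : ∀ ss S t → (∀ {s q} → s ∈ ss → q ∈ S → s ++ q ∷ t ⊆ xs × length (s ++ q ∷ t) ≡ d) →
      ∃ λ ps → length ps ≤ (1 + 6 * length ss) ^ D × (∀ {q} → q ∈ S → map (λ s → color (s ++ q ∷ t)) ss ∈ ps)) where

    module _ (r M : ℕ) (t : List A) (r+t : r + suc (length t) ≡ d) where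

      Constant : List A → List A → Set
      Constant pre S = ∀ {s} → s ⊆ pre → length s ≡ r →
                       ∀ {p q} → p ∈ S → q ∈ S → color (s ++ p ∷ t) ≡ color (s ++ q ∷ t)

      -- The color of s ++ p ∷ t with s of length r does not depend on p, as long as p comes after s.
      Stable : List A → List A → Set
      Stable pre [] = ⊤
      Stable pre (p ∷ T) = Constant pre (p ∷ T) × Stable (pre ++ [ p ]) T

      -- Greedy choice: the head p joins `pre`, and the rest is thinned to a class of points that
      -- induce the same colors with all r-subsets of `pre ++ [ p ]`. The bound M on the final
      -- length of `pre` keeps the number of these subsets at most M^r in every round.
      stableSublist : ∀ j pre S → length pre + j ≤ M → (pre ++ S) ++ t ⊆ xs → suc (classes D r M) ^ j < length S →
        Constant pre S → ∃ λ T → T ⊆ S × length T ≡ suc j × Stable pre T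
      stableSublist zero pre (p ∷ S) _ _ _ const = [ p ] , refl ∷ minimum S , refl
        , (λ s⊆ len → λ { (here refl) (here refl) → refl }) , tt
      stableSublist (suc j) pre (p ∷ S) len sub (s≤s big) const
        with patterns (combinations r (pre ++ [ p ])) S t good
        where
        good : ∀ {s q} → s ∈ combinations r (pre ++ [ p ]) → q ∈ S → s ++ q ∷ t ⊆ xs × length (s ++ q ∷ t) ≡ d
        good {s} {q} s∈ q∈ with ∈-combinations⁻ r (pre ++ [ p ]) s∈
        ... | s⊆ , refl = ⊆-trans (subst₂ _⊆_ (++-assoc s [ q ] t) (cong (_++ t) (++-assoc pre [ p ] S))
                            (++⁺ (++⁺ s⊆ (from∈ q∈)) ⊆-refl)) sub , trans (length-++ s) r+t
      ... | ps , ps≤ , ps∋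
        with pigeonhole (≡-dec _≟ₛ_) (λ q → map (λ s → color (s ++ q ∷ t)) (combinations r (pre ++ [ p ]))) ps (suc (classes D r M) ^ j) S ps∋
          (ℕ.≤-<-trans (ℕ.*-monoˡ-≤ (suc (classes D r M) ^ j) (ℕ.≤-trans ps≤ few))
            (ℕ.<-≤-trans (ℕ.m<n+m (classes D r M * suc (classes D r M) ^ j) (ℕ.m^n>0 (suc (classes D r M)) j)) big))
        where
        len′ : length (pre ++ [ p ]) ≤ M
        len′ = begin
          length (pre ++ [ p ])     ≡⟨ length-++ pre ⟩
          length pre + 1            ≤⟨ ℕ.+-monoʳ-≤ (length pre) (s≤s z≤n) ⟩
          length pre + suc j        ≤⟨ len ⟩
          M                         ∎
          where open ℕ.≤-Reasoning
        few : (1 + 6 * length (combinations r (pre ++ [ p ]))) ^ D ≤ classes D r M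
        few = ℕ.^-monoˡ-≤ D (s≤s (ℕ.*-monoʳ-≤ 6 (ℕ.≤-trans (length-combinations r (pre ++ [ p ])) (ℕ.^-monoˡ-≤ r len′))))
      ... | S′ , S′⊆ , big′ , same
        with stableSublist j (pre ++ [ p ]) S′
               (ℕ.≤-trans (ℕ.≤-reflexive (trans (cong (_+ j) (length-++ pre)) (ℕ.+-assoc (length pre) 1 j))) len)
               (⊆-trans (subst (_⊆ (pre ++ p ∷ S) ++ t) (cong (_++ t) (sym (++-assoc pre [ p ] S′)))
                 (++⁺ (++⁺ (⊆-refl {x = pre}) (refl ∷ S′⊆)) ⊆-refl)) sub)
               big′
               (λ {s} s⊆ → λ { refl p∈ q∈ → map-≡-∈ (same p∈ q∈) (∈-combinations⁺ s⊆) })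
      ... | T , T⊆ , lenT , stable = p ∷ T , refl ∷ ⊆-trans T⊆ S′⊆ , cong suc lenT
          , (λ s⊆ len p∈ q∈ → const s⊆ len (Any-resp-⊆ T⊆S p∈) (Any-resp-⊆ T⊆S q∈)) , stable
        where T⊆S = refl ∷ ⊆-trans T⊆ S′⊆

      -- Induction along T, where `s₁` collects the part of the tuple already passed and `s₂` is
      -- what remains before q. When q is reached, constancy at that position compares it with the
      -- later point l.
      stable-last : ∀ {pre} T l → Stable pre (T ++ [ l ]) → ∀ s₁ s₂ {q s} → s₁ ⊆ pre → s ⊆ T → s ≡ s₂ ++ [ q ] →
        length (s₁ ++ s₂) ≡ r → color ((s₁ ++ s₂) ++ q ∷ t) ≡ color ((s₁ ++ s₂) ++ l ∷ t)
      stable-last [] l _ s₁ [] _ [] ()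
      stable-last [] l _ s₁ (_ ∷ _) _ [] ()
      stable-last (p ∷ T) l (_ , stable) s₁ s₂ s₁⊆ (_ ∷ʳ sub) e len =
        stable-last T l stable s₁ s₂ (⊆-trans s₁⊆ (++⁺ʳ [ p ] ⊆-refl)) sub e len
      stable-last (p ∷ T) l (const , _) s₁ [] s₁⊆ (refl ∷ sub) refl len =
        const (subst (_⊆ _) (sym (++-identityʳ s₁)) s₁⊆) len (here refl) (there (∈-++⁺ʳ T (here refl)))
      stable-last (p ∷ T) l (_ , stable) s₁ (_ ∷ s₂) {q} s₁⊆ (refl ∷ sub) refl len =
        subst (λ s → color (s ++ q ∷ t) ≡ color (s ++ l ∷ t)) assoc
          (stable-last T l stable (s₁ ++ [ p ]) s₂ (++⁺ s₁⊆ ⊆-refl) sub refl (trans (cong length assoc) len))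
        where assoc = ++-assoc s₁ [ p ] s₂

    Monochromatic : ℕ → List A → List A → Sign → Set
    Monochromatic r t T σ = ∀ {s} → s ⊆ T → length s ≡ r → color (s ++ t) ≡ σ

    module _ (size : Sign → ℕ) where

      Homogeneous : ℕ → List A → List A → Set
      Homogeneous r t S = ∃₂ λ σ T → T ⊆ S × length T ≡ size σ × Monochromatic r t T σ

      module _ (base : ℕ) (pairs : ∀ t S → 2 + length t ≡ d → S ++ t ⊆ xs → base ≤ length S → Homogeneous 2 t S) where

        -- In a stable sequence the last entry of a tuple may be replaced by the last point `l` of
        -- the sequence. Hence the tuples from the others get the color of their initial parts, with
        -- `l` added to the fixed suffix `t`.
        homogeneous : ∀ i t S → 2 + i + length t ≡ d → S ++ t ⊆ xs → ramseyBound D base i ≤ length S → Homogeneous (2 + i) t S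
        homogeneous zero = pairs
        homogeneous (suc i) t S len sub big
          with stableSublist r M t r+t M [] S ℕ.≤-refl sub big empty
          where
          r = 2 + i
          M = ramseyBound D base i
          r+t : r + suc (length t) ≡ d
          r+t = trans (ℕ.+-suc r (length t)) len
          empty : Constant r M t r+t [] S
          empty [] ()
        ... | P , P⊆ , lenP , stable with initLast P
        ... | T ∷ʳ′ l
          with homogeneous i (l ∷ t) T (trans (ℕ.+-suc (2 + i) (length t)) len)
                 (⊆-trans (subst (_⊆ S ++ t) (++-assoc T [ l ] t) (++⁺ P⊆ ⊆-refl)) sub)
                 (ℕ.≤-reflexive (sym (ℕ.suc-injective (trans (sym (trans (length-++ T) (ℕ.+-comm (length T) 1))) lenP))))
        ... | σ , U , U⊆ , lenU , mono = σ , U , ⊆-trans U⊆ (⊆-trans (++⁺ʳ [ l ] ⊆-refl) P⊆) , lenU , mono′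
          where
          mono′ : Monochromatic (3 + i) t U σ
          mono′ {s} s⊆ lens with initLast s
          ... | u ∷ʳ′ q = trans (cong color (++-assoc u [ q ] t))
            (trans (stable-last (2 + i) (ramseyBound D base i) t (trans (ℕ.+-suc (2 + i) (length t)) len) T l stable [] u [] (⊆-trans s⊆ U⊆) refl lenu)
              (mono (⊆-trans (++⁺ʳ [ q ] ⊆-refl) s⊆) lenu))
            where
            lenu : length u ≡ 2 + i
            lenu = ℕ.suc-injective (trans (sym (trans (length-++ u) (ℕ.+-comm (length u) 1))) lens)

open Combinatorics

-- Increasing sublists and the bound for pairs

AllPairs-⊆ : ∀ {A : Set} {R : A → A → Set} {s t : List A} → s ⊆ t → AllPairs R t → AllPairs R s
AllPairs-⊆ [] [] = []
AllPairs-⊆ (_ ∷ʳ s⊆) (_ ∷ t) = AllPairs-⊆ s⊆ t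
AllPairs-⊆ (refl ∷ s⊆) (x ∷ t) = All-resp-⊆ s⊆ x ∷ AllPairs-⊆ s⊆ t

allFin-increasing : ∀ N → Increasing (allFin N)
allFin-increasing N = AllPairs.tabulate⁺-< λ i<j → i<j

increasing-⊆ : ∀ {N} {s t : List (Fin N)} → Increasing s → Increasing t → (∀ {x} → x ∈ s → x ∈ t) → s ⊆ t
increasing-⊆ {s = []} _ _ _ = minimum _
increasing-⊆ {s = x ∷ s} {[]} _ _ s∈t with () ← s∈t (here refl)
increasing-⊆ {s = x ∷ s} {y ∷ t} (x<s ∷ incₛ) (y<t ∷ incₜ) s∈t with s∈t (here refl)
... | here refl = refl ∷ increasing-⊆ incₛ incₜ (λ z∈s → later (All.lookup x<s z∈s) (s∈t (there z∈s)))
  where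
  later : ∀ {z} → x Fin.< z → z ∈ x ∷ t → z ∈ t
  later x<z (here refl) = contradiction x<z (Fin.<-irrefl refl)
  later _ (there z∈t) = z∈t
... | there x∈t = y ∷ʳ increasing-⊆ (x<s ∷ incₛ) incₜ first
  where
  later : ∀ {z} → y Fin.< z → z ∈ y ∷ t → z ∈ t
  later y<z (here refl) = contradiction y<z (Fin.<-irrefl refl)
  later _ (there z∈t) = z∈t
  first : ∀ {z} → z ∈ x ∷ s → z ∈ t
  first (here refl) = x∈t
  first (there z∈s) = later (Fin.<-trans (All.lookup y<t x∈t) (All.lookup x<s z∈s)) (s∈t (there z∈s))

baseBound : ℕ → ℕ → ℕ
baseBound k n = (3 ℕ.+ k) ℕ.* n ℕ.^ 2

-- For target size n = m + 1, two applications of Mirsky's theorem need more than m (1 + m (d + 1))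
-- lines, where d + 1 = 2 + k is the size for color zero. One more line is allowed for because one
-- may have to be discarded as horizontal.
baseBound-≥ : ∀ k m → 2 ℕ.+ m ℕ.* suc (m ℕ.* (2 ℕ.+ k)) ℕ.≤ baseBound k (suc m)
baseBound-≥ k m = subst (2 ℕ.+ m ℕ.* suc (m ℕ.* (2 ℕ.+ k)) ℕ.≤_) (identity k m) (ℕ.m≤m+n _ _)
  where
  identity : ∀ k m → 2 ℕ.+ m ℕ.* (1 ℕ.+ m ℕ.* (2 ℕ.+ k)) ℕ.+ (3 ℕ.* m ℕ.+ m ℕ.* m ℕ.+ (1 ℕ.+ k) ℕ.+ 2 ℕ.* (1 ℕ.+ k) ℕ.* m) ≡
                     (3 ℕ.+ k) ℕ.* ((1 ℕ.+ m) ℕ.* ((1 ℕ.+ m) ℕ.* 1))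
  identity = solve-∀

-- Lines in a plane, simplices and one-sided subfamilies

module SidedSubfamily (R : RealField) {k N} (H : Fin N → Hyperplane R (suc k)) (gp : GeneralPosition R H) where
  open Arrangement R H gp
  open Linear R
  open ≡-Reasoning

  good : ∀ {s} → s ⊆ allFin N → length s ≡ suc k → Good s
  good s⊆ len = AllPairs-⊆ s⊆ (allFin-increasing N) , len

  -- In the plane of t, let w be a horizontal direction and v the direction of the line q₁.
  -- In the coordinates x₀ + σ v + τ w, the line q is slope q * σ + τ = intercept q.
  module Plane (t : List (Fin N)) (w : V (suc k)) (w∥ : Parallel t w) (last-w : last w ≡ 0r)
    (q₁ q₂ : Fin N) (g₀ : Good (q₁ ∷ q₂ ∷ t)) (q₁w≢0 : nrm q₁ ∙ w ≢ 0r) where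

    private
      len : length (nrm q₁ ∷ map nrm t) ℕ.< suc k
      len = ℕ.≤-reflexive (trans (cong (suc ∘ suc) (length-map nrm t)) (proj₂ g₀))
      ker = kernel (nrm q₁ ∷ map nrm t) len
      v = proj₁ ker
      j = proj₁ (proj₁ (proj₂ ker))
      x₀ = proj₁ (vertex R H gp (proj₁ g₀) (proj₂ g₀))
      x₀∈ : Meets R H (q₁ ∷ q₂ ∷ t) x₀
      x₀∈ = proj₁ (proj₂ (vertex R H gp (proj₁ g₀) (proj₂ g₀)))

      v≢0 : v j ≢ 0r
      v≢0 = proj₂ (proj₁ (proj₂ ker))

      q₁v≡0 : nrm q₁ ∙ v ≡ 0r
      q₁v≡0 = All.head (proj₂ (proj₂ ker))

      v∥ : Parallel t v
      v∥ = All.map⁻ (All.tail (proj₂ (proj₂ ker)))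

      q₂v≢0 : nrm q₂ ∙ v ≢ 0r
      q₂v≢0 e = v≢0 (parallel-zero v g₀ (q₁v≡0 ∷ e ∷ v∥) j)

    -- Since w is horizontal, the height of a point is last x₀ + σ (last v). Where this vanishes on
    -- the line q, `height q` equals τ (last v), the scaled position of the intersection with x_d =
    -- 0. As a polynomial expression it also makes sense for last v = 0, when the plane has constant
    -- height.
    slope intercept height : Fin N → Carrier
    slope q = (nrm q ∙ v) ÷ (nrm q ∙ w)
    intercept q = (off q - nrm q ∙ x₀) ÷ (nrm q ∙ w)
    height q = slope q * last x₀ + intercept q * last v

    private
      module Coordinates (y : V (suc k)) (y∈ : Meets R H t y) where
        z z₁ : V (suc k)
        z = y ⊕ ⊖ x₀
        τ σ : Carrier
        τ = (nrm q₁ ∙ z) ÷ (nrm q₁ ∙ w)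
        z₁ = z ⊕ ⊖ (τ ⊙ w)
        σ = (nrm q₂ ∙ z₁) ÷ (nrm q₂ ∙ v)

        minus-multiple : ∀ f (x u : V (suc k)) c → f ∙ (x ⊕ ⊖ (c ⊙ u)) ≡ f ∙ x - c * f ∙ u
        minus-multiple f x u c = trans (∙-difference f (c ⊙ u) x) (cong (λ a → f ∙ x - a) (∙-⊙ f c u))

        vanishes : ∀ f (x u : V (suc k)) → f ∙ u ≢ 0r → f ∙ (x ⊕ ⊖ (((f ∙ x) ÷ (f ∙ u)) ⊙ u)) ≡ 0r
        vanishes f x u fu≢0 = trans (minus-multiple f x u _) (trans (cong (λ a → f ∙ x - a) (÷-* (f ∙ x) fu≢0)) (-‿inverseʳ _))

        -- The vector z₁ - σ v is parallel to q₁, as τ makes z₁ parallel to it and v is its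
        -- direction; to q₂ by the choice of σ; and to `t`. So it is zero.
        coordinates : ∀ i → z₁ i ≡ σ * v i
        coordinates i = -≡0 (parallel-zero (z₁ ⊕ ⊖ (σ ⊙ v)) g₀
          ( trans (minus-multiple (nrm q₁) z₁ v σ) (trans (cong₂ (λ a b → a - σ * b) (vanishes (nrm q₁) z w q₁w≢0) q₁v≡0)
              (trans (cong (λ a → 0r - a) (zeroʳ σ)) (-‿inverseʳ 0r)))
          ∷ vanishes (nrm q₂) z₁ v q₂v≢0
          ∷ parallel-- z₁ (σ ⊙ v)
              (parallel-- z (τ ⊙ w) (difference-parallel x₀ y (All.tail (All.tail x₀∈)) y∈) (parallel-⊙ τ w w∥))
              (parallel-⊙ σ v v∥)) i)

        last-y : last y ≡ last x₀ + σ * last v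
        last-y = begin
          last y                               ≡⟨ solve 3 (λ y x t → y := x :+ (y :+ :- x :+ :- t) :+ t) refl (last y) (last x₀) (τ * last w) ⟩
          last x₀ + z₁ (fromℕ k) + τ * last w  ≡⟨ cong (last x₀ + z₁ (fromℕ k) +_) (trans (cong (τ *_) last-w) (zeroʳ τ)) ⟩
          last x₀ + z₁ (fromℕ k) + 0r          ≡⟨ +-identityʳ _ ⟩
          last x₀ + z₁ (fromℕ k)                            ≡⟨ cong (last x₀ +_) (coordinates (fromℕ k)) ⟩
          last x₀ + σ * last v                              ∎

        on-line : ∀ {q} → nrm q ∙ w ≢ 0r → OnHyperplane R (H q) y → intercept q ≡ slope q * σ + τ
        on-line {q} qw≢0 on = -≡0 (*-nonzero (begin
          nrm q ∙ w * (intercept q - (slope q * σ + τ))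
            ≡⟨ solve 5 (λ b i m s t → b :* (i :+ :- (m :* s :+ t)) := i :* b :+ :- (s :* (m :* b)) :+ :- (t :* b)) refl (nrm q ∙ w) (intercept q) (slope q) σ τ ⟩
          intercept q * nrm q ∙ w - σ * (slope q * nrm q ∙ w) - τ * nrm q ∙ w
            ≡⟨ cong₂ (λ a b → a - σ * b - τ * nrm q ∙ w) (÷-* _ qw≢0) (÷-* _ qw≢0) ⟩
          off q - nrm q ∙ x₀ - σ * nrm q ∙ v - τ * nrm q ∙ w
            ≡⟨ cong (λ a → a - nrm q ∙ x₀ - σ * nrm q ∙ v - τ * nrm q ∙ w) on ⟨
          nrm q ∙ y - nrm q ∙ x₀ - σ * nrm q ∙ v - τ * nrm q ∙ w
            ≡⟨ cong (λ a → a - σ * nrm q ∙ v - τ * nrm q ∙ w) (∙-difference (nrm q) x₀ y) ⟨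
          nrm q ∙ z - σ * nrm q ∙ v - τ * nrm q ∙ w
            ≡⟨ solve 3 (λ a b c → a :+ :- b :+ :- c := (a :+ :- c) :+ :- b) refl _ _ _ ⟩
          nrm q ∙ z - τ * nrm q ∙ w - σ * nrm q ∙ v
            ≡⟨ cong₂ _-_ (minus-multiple (nrm q) z w τ) (∙-⊙ (nrm q) σ v) ⟨
          nrm q ∙ z₁ - nrm q ∙ (σ ⊙ v)
            ≡⟨ cong (λ a → a - nrm q ∙ (σ ⊙ v)) (∙-cong (nrm q) coordinates) ⟩
          nrm q ∙ (σ ⊙ v) - nrm q ∙ (σ ⊙ v)
            ≡⟨ -‿inverseʳ _ ⟩
          0r ∎) qw≢0)

    -- For a common slope m, the vector v - m w is parallel to a, b and `t`, so v = m w. But q₁ is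
    -- parallel to v and not to w, hence m = 0 and v = 0.
    slope-injective : ∀ {a b} → Good (a ∷ b ∷ t) → nrm a ∙ w ≢ 0r → nrm b ∙ w ≢ 0r → slope a ≢ slope b
    slope-injective {a} {b} g aw≢0 bw≢0 e = v≢0 (trans (v≡mw j) (trans (cong (_* w j) m≡0) (zeroˡ (w j))))
      where
      m = slope a
      kills : ∀ {q} → nrm q ∙ w ≢ 0r → slope q ≡ m → nrm q ∙ (v ⊕ ⊖ (m ⊙ w)) ≡ 0r
      kills {q} qw≢0 e′ = trans (∙-difference (nrm q) (m ⊙ w) v) (trans (cong (λ a → nrm q ∙ v - a)
        (trans (∙-⊙ (nrm q) m w) (trans (cong (_* nrm q ∙ w) (sym e′)) (÷-* (nrm q ∙ v) qw≢0)))) (-‿inverseʳ _))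
      v≡mw : ∀ i → v i ≡ m * w i
      v≡mw i = -≡0 (parallel-zero (v ⊕ ⊖ (m ⊙ w)) g
        (kills aw≢0 refl ∷ kills bw≢0 (sym e) ∷ parallel-- v (m ⊙ w) v∥ (parallel-⊙ m w w∥)) i)
      m≡0 : m ≡ 0r
      m≡0 = *-nonzero (begin
        nrm q₁ ∙ w * m      ≡⟨ *-comm _ m ⟩
        m * nrm q₁ ∙ w      ≡⟨ ∙-⊙ (nrm q₁) m w ⟨
        nrm q₁ ∙ (m ⊙ w)    ≡⟨ ∙-cong (nrm q₁) v≡mw ⟨
        nrm q₁ ∙ v          ≡⟨ q₁v≡0 ⟩
        0r                  ∎) q₁w≢0

    -- Subtracting the equations of the two lines gives σ (slope a - slope b) = intercept a -
    -- intercept b, so the height of the vertex times the difference of the slopes is the difference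
    -- of the `height` values.
    color-pair : ∀ {a b} → Good (a ∷ b ∷ t) → nrm a ∙ w ≢ 0r → nrm b ∙ w ≢ 0r →
                 color (a ∷ b ∷ t) ≡ sgn (height a - height b) ⊗ sgn (slope a - slope b)
    color-pair {a} {b} g aw≢0 bw≢0 = trans (color-vertex y g y∈)
      (sgn-quotient (λ e → slope-injective g aw≢0 bw≢0 (-≡0 e)) (begin
        last y * (slope a - slope b)
          ≡⟨ cong (_* (slope a - slope b)) last-y ⟩
        (last x₀ + σ * last v) * (slope a - slope b)
          ≡⟨ solve 6 (λ x s l m n t → (x :+ s :* l) :* (m :+ :- n) :=
               (m :* x :+ (m :* s :+ t) :* l) :+ :- (n :* x :+ (n :* s :+ t) :* l)) refl (last x₀) σ (last v) (slope a) (slope b) τ ⟩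
        (slope a * last x₀ + (slope a * σ + τ) * last v) - (slope b * last x₀ + (slope b * σ + τ) * last v)
          ≡⟨ cong₂ (λ c d → (slope a * last x₀ + c * last v) - (slope b * last x₀ + d * last v))
               (on-line aw≢0 (All.head y∈)) (on-line bw≢0 (All.head (All.tail y∈))) ⟨
        height a - height b ∎))
      where
      y = proj₁ (vertex R H gp (proj₁ g) (proj₂ g))
      y∈ : Meets R H (a ∷ b ∷ t) y
      y∈ = proj₁ (proj₂ (vertex R H gp (proj₁ g) (proj₂ g)))
      open Coordinates y (All.tail (All.tail y∈))

  -- For color zero a simplex is enough: d + 1 hyperplanes already contradict general position.
  size : ℕ → Sign → ℕ
  size n neg = n
  size n zer = suc (suc k)
  size n pos = n

  open ErdősRado color _≟ₛ_ (allFin N) (suc k) (suc (suc k))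
    (λ ss S t g → colorPatterns ss S t λ s∈ q∈ → good (proj₁ (g s∈ q∈)) (proj₂ (g s∈ q∈))) public

  _<?_ : Decidable _<_
  x <? y with <-trichotomy x y
  ... | inj₁ x<y = yes x<y
  ... | inj₂ (inj₁ refl) = no (<-irrefl x)
  ... | inj₂ (inj₂ y<x) = no λ x<y → <-irrefl x (<-trans x<y y<x)

  -- Lines ordered both by slope and by height, in the same or in opposite ways, meet above or below;
  -- if neither order relates any two of them, they all meet at height zero.
  monochromaticPairs : ∀ m t S → S ++ t ⊆ allFin N → 2 ℕ.+ length t ≡ suc k → ∀ (slope height : Fin N → Carrier) →
    (∀ {a b} → a ∷ b ∷ [] ⊆ S → slope a ≢ slope b ×
      color (a ∷ b ∷ t) ≡ sgn (height a - height b) ⊗ sgn (slope a - slope b)) →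
    m ℕ.* suc (m ℕ.* (2 ℕ.+ k)) ℕ.< length S → Homogeneous (size (suc m)) 2 t S
  monochromaticPairs m t S sub len slope height pair big
    with Positive.chain-or-antichain (suc (m ℕ.* (2 ℕ.+ k))) m S big
    where
    module Positive = Mirsky (λ a b → slope a < slope b × height a < height b)
      (λ a b → (slope a <? slope b) ×-dec (height a <? height b))
      (λ (p , q) (p′ , q′) → <-trans p p′ , <-trans q q′) (λ (p , _) → <-irrefl _ p)
  ... | inj₁ (T , T⊆ , lenT , chain) = pos , T , T⊆ , lenT , mono
    where
    mono : Monochromatic 2 t T pos
    mono {a ∷ b ∷ []} ab⊆ refl with pair (⊆-trans ab⊆ T⊆)
    ... | slope≢ , eq with chain (Any-resp-⊆ ab⊆ (here refl)) (Any-resp-⊆ ab⊆ (there (here refl)))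
    ... | inj₁ refl = contradiction refl slope≢
    ... | inj₂ (inj₁ (p , q)) = trans eq (cong₂ _⊗_ (sgn-<ˡ q) (sgn-<ˡ p))
    ... | inj₂ (inj₂ (p , q)) = trans eq (cong₂ _⊗_ (sgn-<ʳ q) (sgn-<ʳ p))
  ... | inj₂ (T , T⊆ , lenT , antichain) with Negative.chain-or-antichain (2 ℕ.+ k) m T lenT
    where
    module Negative = Mirsky (λ a b → slope a < slope b × height b < height a)
      (λ a b → (slope a <? slope b) ×-dec (height b <? height a))
      (λ (p , q) (p′ , q′) → <-trans p p′ , <-trans q′ q) (λ (p , _) → <-irrefl _ p)
  ... | inj₁ (U , U⊆ , lenU , chain) = neg , U , ⊆-trans U⊆ T⊆ , lenU , mono
    where
    mono : Monochromatic 2 t U neg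
    mono {a ∷ b ∷ []} ab⊆ refl with pair (⊆-trans ab⊆ (⊆-trans U⊆ T⊆))
    ... | slope≢ , eq with chain (Any-resp-⊆ ab⊆ (here refl)) (Any-resp-⊆ ab⊆ (there (here refl)))
    ... | inj₁ refl = contradiction refl slope≢
    ... | inj₂ (inj₁ (p , q)) = trans eq (cong₂ _⊗_ (sgn-<ʳ q) (sgn-<ˡ p))
    ... | inj₂ (inj₂ (p , q)) = trans eq (cong₂ _⊗_ (sgn-<ˡ q) (sgn-<ʳ p))
  ... | inj₂ (U , U⊆ , lenU , antichain′) =
    zer , take (2 ℕ.+ k) U , ⊆-trans (take-⊆ (2 ℕ.+ k) U) (⊆-trans U⊆ T⊆)
    , trans (length-take (2 ℕ.+ k) U) (ℕ.m≤n⇒m⊓n≡m lenU) , mono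
    where
    mono : Monochromatic 2 t (take (2 ℕ.+ k) U) zer
    mono {a ∷ b ∷ []} ab⊆ refl with pair (⊆-trans ab⊆ (⊆-trans (take-⊆ (2 ℕ.+ k) U) (⊆-trans U⊆ T⊆)))
    ... | slope≢ , eq = trans eq (zero-height (<-trichotomy (slope a) (slope b)) (<-trichotomy (height a) (height b)))
      where
      a∈ : a ∈ U
      a∈ = Any-resp-⊆ (take-⊆ (2 ℕ.+ k) U) (Any-resp-⊆ ab⊆ (here refl))
      b∈ : b ∈ U
      b∈ = Any-resp-⊆ (take-⊆ (2 ℕ.+ k) U) (Any-resp-⊆ ab⊆ (there (here refl)))
      up : ∀ {x} → x ∈ U → x ∈ T
      up = Any-resp-⊆ U⊆
      zero-height : (slope a < slope b) ⊎ (slope a ≡ slope b) ⊎ (slope b < slope a) →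
        (height a < height b) ⊎ (height a ≡ height b) ⊎ (height b < height a) →
        sgn (height a - height b) ⊗ sgn (slope a - slope b) ≡ zer
      zero-height _ (inj₂ (inj₁ e)) =
        cong (_⊗ sgn (slope a - slope b)) (sgn-complete zer (trans (cong (_- height b) e) (-‿inverseʳ _)))
      zero-height (inj₁ p) (inj₁ q) = contradiction (p , q) (antichain (up a∈) (up b∈))
      zero-height (inj₁ p) (inj₂ (inj₂ q)) = contradiction (p , q) (antichain′ a∈ b∈)
      zero-height (inj₂ (inj₁ e)) _ = contradiction e slope≢
      zero-height (inj₂ (inj₂ p)) (inj₁ q) = contradiction (p , q) (antichain′ b∈ a∈)
      zero-height (inj₂ (inj₂ p)) (inj₂ (inj₂ q)) = contradiction (p , q) (antichain (up b∈) (up a∈))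

  homogeneous-⊆ : ∀ {n r t S S′} → S′ ⊆ S → Homogeneous (size n) r t S′ → Homogeneous (size n) r t S
  homogeneous-⊆ S′⊆ (σ , T , T⊆ , lenT , mono) = σ , T , ⊆-trans T⊆ S′⊆ , lenT , mono

  module _ (t S : List (Fin N)) (len : 2 ℕ.+ length t ≡ suc k) (sub : S ++ t ⊆ allFin N)
    (w : V (suc k)) (j : Fin (suc k)) (w≢0 : w j ≢ 0r) (w∥ : Parallel t w) (last-w : last w ≡ 0r) where

    private
      goodPair : ∀ {a b S′} → a ∷ b ∷ [] ⊆ S′ → S′ ⊆ S → Good (a ∷ b ∷ t)
      goodPair ab⊆ S′⊆ = good (⊆-trans (++⁺ (⊆-trans ab⊆ S′⊆) ⊆-refl) sub) len

    -- Two such lines together with `t` would be d hyperplanes parallel to the nonzero vector w.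
    horizontal-≤1 : ∀ {Z} → Z ⊆ S → (∀ {q} → q ∈ Z → nrm q ∙ w ≡ 0r) → length Z ℕ.≤ 1
    horizontal-≤1 {[]} _ _ = ℕ.z≤n
    horizontal-≤1 {_ ∷ []} _ _ = ℕ.s≤s ℕ.z≤n
    horizontal-≤1 {a ∷ b ∷ Z} Z⊆ Z≡0 = contradiction
      (parallel-zero w (goodPair (refl ∷ refl ∷ minimum Z) Z⊆) (Z≡0 (here refl) ∷ Z≡0 (there (here refl)) ∷ w∥) j) w≢0

    transversals : ∀ m S′ → S′ ⊆ S → (∀ {q} → q ∈ S′ → nrm q ∙ w ≢ 0r) →
      suc m ℕ.* suc (suc m ℕ.* (2 ℕ.+ k)) ℕ.< length S′ → Homogeneous (size (2 ℕ.+ m)) 2 t S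
    -- Target size at least 2 guarantees two lines, and these supply the coordinates of the plane.
    transversals m (_ ∷ []) _ _ (ℕ.s≤s ())
    transversals m (q₁ ∷ q₂ ∷ S′) S′⊆ w≢ big =
      homogeneous-⊆ S′⊆ (monochromaticPairs (suc m) t (q₁ ∷ q₂ ∷ S′) (⊆-trans (++⁺ S′⊆ ⊆-refl) sub) len slope height pair big)
      where
      open Plane t w w∥ last-w q₁ q₂ (goodPair (refl ∷ refl ∷ minimum S′) S′⊆) (w≢ (here refl))
      pair : ∀ {a b} → a ∷ b ∷ [] ⊆ q₁ ∷ q₂ ∷ S′ → slope a ≢ slope b ×
             color (a ∷ b ∷ t) ≡ sgn (height a - height b) ⊗ sgn (slope a - slope b)
      pair ab⊆ = slope-injective g aw bw , color-pair g aw bw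
        where
        g = goodPair ab⊆ S′⊆
        aw = w≢ (Any-resp-⊆ ab⊆ (here refl))
        bw = w≢ (Any-resp-⊆ ab⊆ (there (here refl)))

    homogeneousPairs : ∀ m → baseBound k (2 ℕ.+ m) ℕ.≤ length S → Homogeneous (size (2 ℕ.+ m)) 2 t S
    homogeneousPairs m big = transversals m (filter (¬? ∘ horizontal?) S) (filter-⊆ (¬? ∘ horizontal?) S)
      (λ q∈ → proj₂ (∈-filter⁻ (¬? ∘ horizontal?) {xs = S} q∈))
      (ℕ.s≤s⁻¹ (ℕ.≤-trans (ℕ.≤-trans (baseBound-≥ k (suc m)) big)
        (ℕ.≤-trans (ℕ.≤-reflexive (sym (length-filter-¬ horizontal? S)))
          (ℕ.+-monoˡ-≤ _ (horizontal-≤1 (filter-⊆ horizontal? S) (λ q∈ → proj₂ (∈-filter⁻ horizontal? {xs = S} q∈)))))))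
      where
      horizontal? : ∀ q → Dec (nrm q ∙ w ≡ 0r)
      horizontal? q = (nrm q ∙ w) ≟ 0r

  -- The horizontal direction w of the plane of `t` exists because the last coordinate and the d - 2
  -- normals are only d - 1 forms.
  pairs : ∀ m t S → 2 ℕ.+ length t ≡ suc k → S ++ t ⊆ allFin N → baseBound k (2 ℕ.+ m) ℕ.≤ length S →
          Homogeneous (size (2 ℕ.+ m)) 2 t S
  pairs m t S len sub big =
    let w , (j , w≢0) , forms≡0 = kernel (unit (fromℕ k) ∷ map nrm t)
                                    (ℕ.≤-reflexive (trans (cong (suc ∘ suc) (length-map nrm t)) len))
    in homogeneousPairs t S len sub w j w≢0 (All.map⁻ (All.tail forms≡0))
         (trans (sym (unit-∙ (fromℕ k) w)) (All.head forms≡0)) m big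

  private
    All-ʳ++-map : ∀ {P : Fin N → Set} rp {J J′} → (All P J → All P J′) → All P (rp ʳ++ J) → All P (rp ʳ++ J′)
    All-ʳ++-map [] f = f
    All-ʳ++-map (x ∷ rp) f = All-ʳ++-map rp λ { (px ∷ pJ) → px ∷ f pJ }

    All-ʳ++ʳ : ∀ {P : Fin N → Set} rp {J} → All P (rp ʳ++ J) → All P J
    All-ʳ++ʳ [] p = p
    All-ʳ++ʳ (x ∷ rp) p = All.tail (All-ʳ++ʳ rp p)

    length-ʳ++ : ∀ rp (a : Fin N) J → length (rp ʳ++ (a ∷ J)) ≡ suc (length (rp ʳ++ J))
    length-ʳ++ [] a J = refl
    length-ʳ++ (x ∷ rp) a J = trans (length-ʳ++ rp x (a ∷ J)) (cong suc (trans (length-ʳ++ rp a J) (sym (length-ʳ++ rp x J))))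

  -- As h precedes all of `ys`, the two subsets differ already in their first entries.
  no-common-vertex : ∀ {h s ys} → h ∷ ys ⊆ allFin N → length ys ≡ suc k → Good (h ∷ s) →
                     ∀ x → Meets R H (h ∷ s) x → ¬ Meets R H ys x
  no-common-vertex {ys = b ∷ bs} sub len (inc , lens) x x∈ x∈′ with AllPairs-⊆ sub (allFin-increasing N)
  ... | h<ys ∷ incys = Fin.<-irrefl (vertex-head R H gp inc incys lens len x x∈ x∈′) (All.head h<ys)

  -- If all the vertices of a simplex have height zero then so do, by induction on the dimension,
  -- all the points of its flats, including the whole space.
  simplex : ∀ h ys → h ∷ ys ⊆ allFin N → length ys ≡ suc k → ¬ Monochromatic (suc k) [] (h ∷ ys) zer
  -- The empty list of hyperplanes cuts out the whole space, in which the all-ones point has height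
  -- 1.
  simplex h ys sub len mono = 0≢1 (sym (flat (reverse ys) [] (reverse-involutive ys) (λ _ → 1r) []))
    where
    height-zero : ∀ {s y} → s ⊆ h ∷ ys → length s ≡ suc k → Meets R H s y → last y ≡ 0r
    height-zero {s} {y} s⊆ lens y∈ = sgn-sound (trans (sym (color-vertex y (good (⊆-trans s⊆ sub) lens) y∈))
      (trans (cong color (sym (++-identityʳ s))) (mono s⊆ lens)))

    -- J defines the flat, and `rp` holds in reverse the members of `ys` still to be added. The
    -- vertex p of h and `ys` without a, and the vertex p′ of `ys`, lie on the flat of J at height
    -- zero, and p is not on a. Moving y in the direction p - p′ until it hits a therefore leaves
    -- its height unchanged and brings it to the flat of `a ∷ J`.
    flat : ∀ rp J → rp ʳ++ J ≡ ys → ∀ y → Meets R H J y → last y ≡ 0r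
    flat [] J refl y y∈ = height-zero {y = y} (h ∷ʳ ⊆-refl) len y∈
    flat (a ∷ rp) J refl y y∈ = begin
      last y                         ≡⟨ +-identityʳ _ ⟨
      last y + 0r                    ≡⟨ cong (last y +_) (trans (cong (c *_) (trans (cong₂ _-_ last-p last-p′) (-‿inverseʳ 0r))) (zeroʳ c)) ⟨
      last y + c * (last p - last p′) ≡⟨ flat rp (a ∷ J) refl y′ (on-a ∷ All.zipWith on-J (y∈ , All.zip (p∈J , All.tail p′∈))) ⟩
      0r                             ∎
      where
      s⊆ : h ∷ (rp ʳ++ J) ⊆ h ∷ ys
      s⊆ = refl ∷ ʳ++⁺ (⊆-refl {x = rp}) (a ∷ʳ ⊆-refl)
      lens : length (h ∷ (rp ʳ++ J)) ≡ suc k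
      lens = trans (sym (length-ʳ++ rp a J)) len
      gₚ = good (⊆-trans s⊆ sub) lens
      g = good (⊆-trans (h ∷ʳ ⊆-refl) sub) len
      p = proj₁ (vertex R H gp (proj₁ gₚ) (proj₂ gₚ))
      p∈ : Meets R H (h ∷ (rp ʳ++ J)) p
      p∈ = proj₁ (proj₂ (vertex R H gp (proj₁ gₚ) (proj₂ gₚ)))
      p′ = proj₁ (vertex R H gp (proj₁ g) (proj₂ g))
      p′∈ys : Meets R H ys p′
      p′∈ys = proj₁ (proj₂ (vertex R H gp (proj₁ g) (proj₂ g)))
      last-p = height-zero {y = p} s⊆ lens p∈
      last-p′ = height-zero {y = p′} (h ∷ʳ ⊆-refl) len p′∈ys
      p∈J : Meets R H J p
      p∈J = All-ʳ++ʳ rp (All.tail p∈)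
      p′∈ : Meets R H (a ∷ J) p′
      p′∈ = All-ʳ++ʳ rp p′∈ys

      p∉a : ¬ OnHyperplane R (H a) p
      p∉a on = no-common-vertex sub len gₚ p p∈ (All-ʳ++-map rp (on ∷_) (All.tail p∈))

      c = (off a - nrm a ∙ y) ÷ (nrm a ∙ p - off a)
      y′ = y ⊕ c ⊙ (p ⊕ ⊖ p′)

      moved : ∀ f → f ∙ y′ ≡ f ∙ y + c * (f ∙ p - f ∙ p′)
      moved f = trans (∙-⊕ f y (c ⊙ (p ⊕ ⊖ p′))) (cong (f ∙ y +_) (trans (∙-⊙ f c (p ⊕ ⊖ p′)) (cong (c *_) (∙-difference f p′ p))))

      on-a : OnHyperplane R (H a) y′
      on-a = begin
        nrm a ∙ y′                                    ≡⟨ moved (nrm a) ⟩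
        nrm a ∙ y + c * (nrm a ∙ p - nrm a ∙ p′)      ≡⟨ cong (λ z → nrm a ∙ y + c * (nrm a ∙ p - z)) (All.head p′∈) ⟩
        nrm a ∙ y + c * (nrm a ∙ p - off a)           ≡⟨ cong (nrm a ∙ y +_) (÷-* _ (λ e → p∉a (-≡0 e))) ⟩
        nrm a ∙ y + (off a - nrm a ∙ y)               ≡⟨ solve 2 (λ x o → x :+ (o :+ :- x) := o :+ (x :+ :- x)) refl (nrm a ∙ y) (off a) ⟩
        off a + (nrm a ∙ y - nrm a ∙ y)               ≡⟨ cong (off a +_) (-‿inverseʳ _) ⟩
        off a + 0r                                    ≡⟨ +-identityʳ _ ⟩
        off a                                         ∎

      on-J : ∀ {i} → OnHyperplane R (H i) y × (OnHyperplane R (H i) p × OnHyperplane R (H i) p′) → OnHyperplane R (H i) y′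
      on-J {i} (eʸ , eᵖ , eᵖ′) = trans (moved (nrm i)) (trans (cong₂ (λ u v → u + c * v) eʸ (trans (cong₂ _-_ eᵖ eᵖ′) (-‿inverseʳ _)))
        (trans (cong (off i +_) (zeroʳ c)) (+-identityʳ _)))

  oneSided : ∀ {n T σ} → T ⊆ allFin N → length T ≡ n → Monochromatic (suc k) [] T σ →
    ∃ λ (ι : Fin n → Fin N) → (∀ i j → ι i ≡ ι j → i ≡ j) × (∀ x → IsVertex R (λ i → H (ι i)) x → sgn (last x) ≡ σ)
  oneSided {T = T} {σ} T⊆ refl mono = lookup T , injective , sides
    where
    incT = AllPairs-⊆ T⊆ (allFin-increasing N)

    injective : ∀ i j → lookup T i ≡ lookup T j → i ≡ j
    injective i j e with Fin.<-cmp i j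
    ... | tri< i<j _ _ = contradiction (lookup-increasing incT i j i<j) (Fin.<-irrefl e)
    ... | tri≈ _ i≡j _ = i≡j
    ... | tri> _ _ j<i = contradiction (lookup-increasing incT j i j<i) (Fin.<-irrefl (sym e))

    sides : ∀ x → IsVertex R (λ i → H (lookup T i)) x → sgn (last x) ≡ σ
    sides x (s , s-inc , on) = trans (sym (color-vertex x (incU , lenU) (All.tabulate⁺ on)))
      (trans (cong color (sym (++-identityʳ U))) (mono U⊆ lenU))
      where
      U = tabulate (λ i → lookup T (s i))
      lenU = length-tabulate (λ i → lookup T (s i))
      incU : Increasing U
      incU = AllPairs.tabulate⁺-< λ {i} {j} i<j → lookup-increasing incT (s i) (s j) (s-inc i j i<j)
      U⊆ : U ⊆ T
      U⊆ = increasing-⊆ incU incT λ x∈ → let i , e = ∈-tabulate⁻ {f = λ i → lookup T (s i)} x∈ in subst (_∈ T) (sym e) (∈-lookup (s i))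

-- Bounding the Ramsey numbers by towers

module Arithmetic where
  open import Data.Nat using (_+_; _*_; _^_; _≤_; _<_)
  open ℕ.≤-Reasoning

  1+≤2^ : ∀ {m n} → m ≤ 2 ^ n → suc m ≤ 2 ^ suc n
  1+≤2^ {m} {n} m≤ = begin
    suc m          ≤⟨ ℕ.+-mono-≤ (ℕ.m^n>0 2 n) m≤ ⟩
    2 ^ n + 2 ^ n  ≡⟨ cong (2 ^ n +_) (ℕ.+-identityʳ (2 ^ n)) ⟨
    2 ^ suc n      ∎

  n<2^n : ∀ n → n < 2 ^ n
  n<2^n zero = ℕ.≤-refl
  n<2^n (suc n) = 1+≤2^ {n = n} (n<2^n n)

  n≤2^n : ∀ n → n ≤ 2 ^ n
  n≤2^n n = ℕ.<⇒≤ (n<2^n n)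

  n≤2^⌈log₂n⌉ : ∀ n → n ≤ 2 ^ ⌈log₂ n ⌉
  n≤2^⌈log₂n⌉ n = go n (<-wellFounded n)
    where
    go : ∀ n (rec : Acc _<_ n) → n ≤ 2 ^ ⌈log2⌉ n rec
    go zero _ = z≤n
    go (suc zero) _ = ℕ.≤-refl
    go (suc (suc n)) (acc rs) = begin
      2 + n                            ≡⟨ cong (2 +_) (ℕ.⌊n/2⌋+⌈n/2⌉≡n n) ⟨
      2 + (⌊ n /2⌋ + ⌈ n /2⌉)           ≤⟨ ℕ.+-monoʳ-≤ 2 (ℕ.+-monoˡ-≤ ⌈ n /2⌉ (ℕ.⌊n/2⌋≤⌈n/2⌉ n)) ⟩
      2 + (⌈ n /2⌉ + ⌈ n /2⌉)           ≡⟨ double ⌈ n /2⌉ ⟩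
      2 * suc ⌈ n /2⌉                   ≤⟨ ℕ.*-monoʳ-≤ 2 (go (suc ⌈ n /2⌉) (rs (ℕ.⌈n/2⌉<n n))) ⟩
      2 ^ ⌈log2⌉ (suc (suc n)) (acc rs)  ∎
      where
      double : ∀ m → 2 + (m + m) ≡ 2 * (1 + m)
      double = solve-∀

  1≤⌈log₂⌉ : ∀ {n} → 2 ≤ n → 1 ≤ ⌈log₂ n ⌉
  1≤⌈log₂⌉ {suc zero} (s≤s ())
  1≤⌈log₂⌉ {suc (suc n)} _ = s≤s z≤n

  twr-pos : ∀ i {x} → 1 ≤ x → 1 ≤ twr i x
  twr-pos zero x≥1 = x≥1
  twr-pos (suc zero) x≥1 = x≥1
  twr-pos (suc (suc i)) {x} _ = ℕ.m^n>0 2 (twr (suc i) x)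

  -- A constant factor slides to the top of the tower, since (a + 1) 2^t ≤ 2^a 2^t ≤ 2^((a + 1) t)
  -- for t ≥ 1.
  *-twr : ∀ i {x} a → 1 ≤ x → a * twr (suc i) x ≤ twr (suc i) (a * x)
  *-twr zero a _ = ℕ.≤-refl
  *-twr (suc i) zero _ = z≤n
  *-twr (suc i) {x} (suc a) x≥1 = begin
    suc a * 2 ^ t          ≤⟨ ℕ.*-monoˡ-≤ (2 ^ t) (n<2^n a) ⟩
    2 ^ a * 2 ^ t          ≤⟨ ℕ.*-monoˡ-≤ (2 ^ t) (ℕ.^-monoʳ-≤ 2 (ℕ.m≤m*n a t {{>-nonZero t≥1}})) ⟩
    2 ^ (a * t) * 2 ^ t    ≡⟨ ℕ.*-comm (2 ^ (a * t)) (2 ^ t) ⟩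
    2 ^ t * 2 ^ (a * t)    ≡⟨ ℕ.^-distribˡ-+-* 2 t (a * t) ⟨
    2 ^ (suc a * t)        ≤⟨ ℕ.^-monoʳ-≤ 2 (*-twr i (suc a) x≥1) ⟩
    twr (suc (suc i)) (suc a * x) ∎
    where
    t = twr (suc i) x
    t≥1 = twr-pos (suc i) x≥1

  -- Here 3 + r comes from 1 + 6 M^r ≤ 2³ M^r, D is the exponent in `classes`, and 2 covers the two
  -- `suc` in `ramseyBound`.
  rate : ℕ → ℕ → ℕ
  rate D r = 2 + (3 + r) * D

  -- Y is any bound on the binary logarithm of M, so the exponent on the right is C M log M.
  stepUp-≤ : ∀ D r {M Y} → 1 ≤ M → 1 ≤ Y → M ≤ 2 ^ Y → suc (suc (classes D r M) ^ M) ≤ 2 ^ (rate D r * Y * M)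
  stepUp-≤ D r {M} {Y} M≥1 Y≥1 M≤ = begin
    suc (suc (classes D r M) ^ M)  ≤⟨ 1+≤2^ {n = E * Y * M} power ⟩
    2 ^ suc (E * Y * M)            ≤⟨ ℕ.^-monoʳ-≤ 2 (ℕ.+-monoˡ-≤ (E * Y * M) (ℕ.*-mono-≤ Y≥1 M≥1)) ⟩
    2 ^ (Y * M + E * Y * M)        ≡⟨ cong (2 ^_) (ℕ.*-distribʳ-+ M Y (E * Y)) ⟨
    2 ^ (rate D r * Y * M)         ∎
    where
    E = 1 + (3 + r) * D
    inner : 1 + 6 * M ^ r ≤ 2 ^ ((3 + r) * Y)
    inner = begin
      1 + 6 * M ^ r              ≤⟨ ℕ.+-monoˡ-≤ (6 * M ^ r) (ℕ.≤-trans (ℕ.≤-reflexive (sym (ℕ.^-zeroˡ r))) (ℕ.^-monoˡ-≤ r M≥1)) ⟩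
      7 * M ^ r                  ≤⟨ ℕ.*-mono-≤ {7} {8} (ℕ.n≤1+n 7) (ℕ.^-monoˡ-≤ r M≤) ⟩
      2 ^ 3 * (2 ^ Y) ^ r        ≡⟨ cong (2 ^ 3 *_) (trans (ℕ.^-*-assoc 2 Y r) (cong (2 ^_) (ℕ.*-comm Y r))) ⟩
      2 ^ 3 * 2 ^ (r * Y)        ≡⟨ ℕ.^-distribˡ-+-* 2 3 (r * Y) ⟨
      2 ^ (3 + r * Y)            ≤⟨ ℕ.^-monoʳ-≤ 2 (ℕ.+-monoˡ-≤ (r * Y) (ℕ.*-monoʳ-≤ 3 Y≥1)) ⟩
      2 ^ (3 * Y + r * Y)        ≡⟨ cong (2 ^_) (ℕ.*-distribʳ-+ Y 3 r) ⟨
      2 ^ ((3 + r) * Y)          ∎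
    outer : classes D r M ≤ 2 ^ ((3 + r) * D * Y)
    outer = begin
      classes D r M              ≤⟨ ℕ.^-monoˡ-≤ D inner ⟩
      (2 ^ ((3 + r) * Y)) ^ D    ≡⟨ ℕ.^-*-assoc 2 ((3 + r) * Y) D ⟩
      2 ^ ((3 + r) * Y * D)      ≡⟨ cong (2 ^_) (trans (ℕ.*-assoc (3 + r) Y D) (trans (cong ((3 + r) *_) (ℕ.*-comm Y D)) (sym (ℕ.*-assoc (3 + r) D Y)))) ⟩
      2 ^ ((3 + r) * D * Y)      ∎
    power : suc (classes D r M) ^ M ≤ 2 ^ (E * Y * M)
    power = begin
      suc (classes D r M) ^ M           ≤⟨ ℕ.^-monoˡ-≤ M (1+≤2^ {n = (3 + r) * D * Y} outer) ⟩
      (2 ^ suc ((3 + r) * D * Y)) ^ M   ≡⟨ ℕ.^-*-assoc 2 (suc ((3 + r) * D * Y)) M ⟩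
      2 ^ (suc ((3 + r) * D * Y) * M)   ≤⟨ ℕ.^-monoʳ-≤ 2 (ℕ.*-monoˡ-≤ M (ℕ.+-monoˡ-≤ ((3 + r) * D * Y) Y≥1)) ⟩
      2 ^ (E * Y * M)                   ∎

  private
    1≤ramseyBound : ∀ D base i → 1 ≤ base → 1 ≤ ramseyBound D base i
    1≤ramseyBound D base zero base≥1 = base≥1
    1≤ramseyBound D base (suc i) _ = s≤s z≤n

  -- The induction starts after one step, not at the pair bound, because the factor log n arises in
  -- that step.
  ramseyBound-≤-twr : ∀ D b i → ∃ λ c → 1 ≤ c × ∀ n → 2 ≤ n →
    ramseyBound D (suc b * n ^ 2) (suc i) ≤ twr (2 + i) (c * (n ^ 2 * ⌈log₂ n ⌉))
  ramseyBound-≤-twr D b zero = c , s≤s z≤n , λ n n≥2 → begin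
    ramseyBound D (suc b * n ^ 2) 1
      ≤⟨ stepUp-≤ D 2 (ℕ.*-mono-≤ {1} {suc b} (s≤s z≤n) (ℕ.^-monoˡ-≤ 2 (ℕ.≤-trans (s≤s z≤n) n≥2)))
           (ℕ.*-mono-≤ {1} {suc (suc (suc b))} (s≤s z≤n) (1≤⌈log₂⌉ n≥2)) (small n n≥2) ⟩
    2 ^ (rate D 2 * ((3 + b) * ⌈log₂ n ⌉) * (suc b * n ^ 2))
      ≡⟨ cong (2 ^_) (rearrange (rate D 2) (3 + b) ⌈log₂ n ⌉ (suc b) (n ^ 2)) ⟩
    twr 2 (c * (n ^ 2 * ⌈log₂ n ⌉)) ∎
    where
    c = rate D 2 * (3 + b) * suc b
    rearrange : ∀ e x l y m → e * (x * l) * (y * m) ≡ e * x * y * (m * l)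
    rearrange = solve-∀
    -- The logarithm of the pair bound: b + 1 for the constant, 2 for the square, and log n ≥ 1 to
    -- merge them.
    small : ∀ n → 2 ≤ n → suc b * n ^ 2 ≤ 2 ^ ((3 + b) * ⌈log₂ n ⌉)
    small n n≥2 = begin
      suc b * n ^ 2                ≤⟨ ℕ.*-mono-≤ (n≤2^n (suc b)) (ℕ.^-monoˡ-≤ 2 (n≤2^⌈log₂n⌉ n)) ⟩
      2 ^ suc b * (2 ^ L) ^ 2      ≡⟨ cong (2 ^ suc b *_) (trans (ℕ.^-*-assoc 2 L 2) (cong (2 ^_) (ℕ.*-comm L 2))) ⟩
      2 ^ suc b * 2 ^ (2 * L)      ≡⟨ ℕ.^-distribˡ-+-* 2 (suc b) (2 * L) ⟨
      2 ^ (suc b + 2 * L)          ≤⟨ ℕ.^-monoʳ-≤ 2 (ℕ.+-monoˡ-≤ (2 * L) (ℕ.m≤m*n (suc b) L {{>-nonZero (1≤⌈log₂⌉ n≥2)}})) ⟩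
      2 ^ (suc b * L + 2 * L)      ≡⟨ cong (2 ^_) (trans (sym (ℕ.*-distribʳ-+ L (suc b) 2)) (cong (λ z → suc z * L) (ℕ.+-comm b 2))) ⟩
      2 ^ ((3 + b) * L)            ∎
      where L = ⌈log₂ n ⌉
  ramseyBound-≤-twr D b (suc i) with ramseyBound-≤-twr D b i
  ... | c , c≥1 , bounded = (2 + e) * c , ℕ.*-mono-≤ {1} {2 + e} (s≤s z≤n) c≥1 , λ n n≥2 →
    let X = n ^ 2 * ⌈log₂ n ⌉
        M = ramseyBound D (suc b * n ^ 2) (suc i)
        T = twr (suc i) (c * X)
        cX≥1 : 1 ≤ c * X
        cX≥1 = ℕ.*-mono-≤ c≥1 (ℕ.*-mono-≤ (ℕ.^-monoˡ-≤ 2 (ℕ.≤-trans (s≤s z≤n) n≥2)) (1≤⌈log₂⌉ n≥2))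
        T≥1 : 1 ≤ T
        T≥1 = twr-pos (suc i) cX≥1
    in begin
    ramseyBound D (suc b * n ^ 2) (2 + i)
      ≤⟨ stepUp-≤ D (3 + i) (1≤ramseyBound D (suc b * n ^ 2) (suc i) (ℕ.*-mono-≤ {1} {suc b} (s≤s z≤n) (ℕ.^-monoˡ-≤ 2 (ℕ.≤-trans (s≤s z≤n) n≥2))))
           T≥1 (bounded n n≥2) ⟩
    2 ^ (e * T * M)
      ≤⟨ ℕ.^-monoʳ-≤ 2 (begin
           -- The bound T on log M, and the constant e, are each dominated by a power of two, so
           -- they only enlarge the multiple of T in the exponent.
           e * T * M                  ≤⟨ ℕ.*-mono-≤ (ℕ.*-mono-≤ (n≤2^n e) (n≤2^n T)) (bounded n n≥2) ⟩
           2 ^ e * 2 ^ T * 2 ^ T      ≡⟨ trans (cong (_* 2 ^ T) (sym (ℕ.^-distribˡ-+-* 2 e T))) (sym (ℕ.^-distribˡ-+-* 2 (e + T) T)) ⟩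
           2 ^ (e + T + T)            ≤⟨ ℕ.^-monoʳ-≤ 2 (ℕ.+-monoˡ-≤ T (ℕ.+-monoˡ-≤ T (ℕ.m≤m*n e T {{>-nonZero T≥1}}))) ⟩
           2 ^ (e * T + T + T)        ≡⟨ cong (2 ^_) (collect e T) ⟩
           2 ^ ((2 + e) * T)          ≤⟨ ℕ.^-monoʳ-≤ 2 (*-twr i (2 + e) cX≥1) ⟩
           2 ^ twr (suc i) ((2 + e) * (c * X)) ∎) ⟩
    twr (3 + i) ((2 + e) * (c * X))
      ≡⟨ cong (twr (3 + i)) (ℕ.*-assoc (2 + e) c X) ⟨
    twr (3 + i) ((2 + e) * c * X) ∎
    where
    e = rate D (3 + i)
    collect : ∀ e t → e * t + t + t ≡ (2 + e) * t
    collect = solve-∀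

-- Conclusion

open Arithmetic
open import Data.Nat using (_+_; _*_; _^_; _≤_)

-- The dimension is d = 2 + i, so i steps lead from pairs to d-tuples, and the patterns live in
-- dimension 3 + i.
oshProperty : ∀ (R : RealField) i m →
  OSHProperty R (suc i) (2 + m) (ramseyBound (3 + i) (baseBound (suc i) (2 + m)) i)
oshProperty R i m H gp
  with homogeneous (size (2 + m)) (baseBound (suc i) (2 + m)) (pairs m) i [] (allFin _)
         (cong (2 +_) (ℕ.+-identityʳ i)) (subst (_⊆ allFin _) (sym (++-identityʳ (allFin _))) ⊆-refl)
         (ℕ.≤-reflexive (sym (length-tabulate id)))
  where open SidedSubfamily R H gp
... | zer , h ∷ ys , T⊆ , len , mono = ⊥-elim (simplex h ys T⊆ (ℕ.suc-injective len) mono)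
  where open SidedSubfamily R H gp
... | pos , T , T⊆ , len , mono = let ι , injective , sides = oneSided T⊆ len mono in
  ι , injective , inj₁ (λ x v → sgn-sound (sides x v))
  where
  open SidedSubfamily R H gp
  open Signs R using (sgn-sound)
... | neg , T , T⊆ , len , mono = let ι , injective , sides = oneSided T⊆ len mono in
  ι , injective , inj₂ (λ x v → sgn-sound (sides x v))
  where
  open SidedSubfamily R H gp
  open Signs R using (sgn-sound)

theorem4 : ∀ (k : ℕ) → 2 ≤ k →
    ∃ λ (c : ℕ) → ∀ (R : RealField) → ∀ (n : ℕ) → 2 ≤ n →
    OSH≤ R k n (twr k (c * n ^ 2 * ⌈log₂ n ⌉))
theorem4 (suc zero) (s≤s ())
-- In dimension d = 3 + i the first argument is the number d + 1 of coefficients; the second is the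
-- b for which `baseBound (2 + i) n` is `suc b * n ^ 2`. That both equal 4 + i is a coincidence.
theorem4 (suc (suc i)) _ with ramseyBound-≤-twr (4 + i) (4 + i) i
... | c , _ , bounded = c , λ { R (suc zero) (s≤s ()) ; R (suc (suc m)) n≥2 →
  ramseyBound (4 + i) (baseBound (2 + i) (2 + m)) (suc i)
  , subst (λ x → ramseyBound (4 + i) (baseBound (2 + i) (2 + m)) (suc i) ≤ twr (2 + i) x)
      (sym (ℕ.*-assoc c ((2 + m) ^ 2) ⌈log₂ 2 + m ⌉)) (bounded (2 + m) n≥2)
  , oshProperty R (suc i) m }
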